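{- Let $G$ be a biconnected graph. Then: (1) $\mathrm{ch}(G)\le\max_{A\in\mathrm{Part}(G)}\mathrm{ch}(G(A))+2$. (2) $\mathrm{ch}(G)\le\max\bigl(3,\ \max_{A}\mathrm{ch}(G(A))+2\bigr)$, where the inner maximum ranges over the parts $A\in\mathrm{Part}(G)$ that are blocks.
   Context: All graphs are finite, undirected, without loops or multiple edges; $G(U)$ is the subgraph induced on $U$. The choice number $\mathrm{ch}(H)$ is the least $k$ such that for every assignment of lists of $k$ colors to the vertices of $H$ there is a proper coloring in which each vertex receives a color from its list. A connected component means the vertex set of a maximal connected subgraph. A set $R\subset V(G)$ is a cutset if $G-R$ (delete the vertices of $R$) is disconnected; $\mathfrak R_2(G)$ is the set of 2-vertex cutsets. $R$ separates $X$ from $Y$ (where $X,Y\not\subset R$) if no vertex of $X\setminus R$ and no vertex of $Y\setminus R$ lie in a common connected component of $G-R$; $R$ splits $X$ if $X\setminus R$ is not contained in one connected component of $G-R$. $G$ is $k$-connected if $v(G)>k$ and it has no cutset with at most $k-1$ vertices; biconnected = 2-connected, triconnected = 3-connected. Cutsets $S,T\in\mathfrak R_2(G)$ are independent if neither splits the other; $S$ is single if it is independent with all other cutsets in $\mathfrak R_2(G)$; $\mathfrak O(G)$ is the set of single cutsets. A set $A\subset V(G)$ is a part of $G$ if no cutset of $\mathfrak O(G)$ splits $A$ but every vertex outside $A$ is separated from $A$ by some cutset of $\mathfrak O(G)$; $\mathrm{Part}(G)$ is the set of parts. $G'$ is obtained from $G$ by adding all edges $ab$ with $\{a,b\}\in\mathfrak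 O(G)$. A part $A$ is a block if $G'(A)$ is triconnected. The maximum over an empty set is taken to be $-\infty$. -}

module Defs where

open import Data.Nat using (ℕ; _≤_; _<_; _+_)
open import Data.Bool using (Bool; true)
open import Data.Fin using (Fin)
open import Data.Fin.Subset using (Subset; _∈_; _∉_; _⊆_; _⊈_; ∁; _─_; _∪_; ⁅_⁆; ⊤; ∣_∣)
open import Data.List using (List; length)
open import Data.List.Membership.Propositional using () renaming (_∈_ to _∈ˡ_)
open import Data.List.Relation.Unary.Unique.Propositional using (Unique)
open import Data.Product using (Σ; _×_; ∃; ∃-syntax)
open import Data.Sum using (_⊎_)
open import Relation.Nullary using (¬_)
open import Relation.Binary.PropositionalEquality using (_≡_; _≢_)

record Graph (n : ℕ) : Set where
  field
    adj    : Fin n → Fin n → Bool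
    symm   : ∀ u v → adj u v ≡ adj v u
    noLoop : ∀ v → adj v v ≢ true

Edge : ∀ {n} → Graph n → Fin n → Fin n → Set
Edge G u v = Graph.adj G u v ≡ true

data Walk {n : ℕ} (E : Fin n → Fin n → Set) (X : Subset n) : Fin n → Fin n → Set where
  here : ∀ {u} → u ∈ X → Walk E X u u
  step : ∀ {u w v} → u ∈ X → E u w → Walk E X w v → Walk E X u v

SameComp : ∀ {n} → (Fin n → Fin n → Set) → Subset n → Fin n → Fin n → Set
SameComp E X x y = Walk E X x y

Disconnected : ∀ {n} → (Fin n → Fin n → Set) → Subset n → Set
Disconnected {n} E X = Σ (Fin n) λ x → Σ (Fin n) λ y →
  x ∈ X × y ∈ X × ¬ SameComp E X x y

CutsetIn : ∀ {n} → (Fin n → Fin n → Set) → Subset n → Subset n → Set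
CutsetIn E U R = R ⊆ U × Disconnected E (U ─ R)

KConnectedIn : ∀ {n} → (Fin n → Fin n → Set) → Subset n → ℕ → Set
KConnectedIn {n} E U k = k < ∣ U ∣ × ((R : Subset n) → CutsetIn E U R → k ≤ ∣ R ∣)

module _ {n : ℕ} (G : Graph n) where

  private
    E = Edge G

  Cutset : Subset n → Set
  Cutset R = CutsetIn E ⊤ R

  Biconnected : Set
  Biconnected = KConnectedIn E ⊤ 2

  Cutset2 : Subset n → Set
  Cutset2 R = Cutset R × ∣ R ∣ ≡ 2

  Separates : Subset n → Subset n → Subset n → Set
  Separates R X Y = X ⊈ R × Y ⊈ R ×
    (∀ x y → x ∈ X → x ∉ R → y ∈ Y → y ∉ R → ¬ SameComp E (∁ R) x y)

  Splits : Subset n → Subset n → Set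
  Splits R X = Σ (Fin n) λ x → Σ (Fin n) λ y →
    x ∈ X × x ∉ R × y ∈ X × y ∉ R × ¬ SameComp E (∁ R) x y

  Independent : Subset n → Subset n → Set
  Independent S T = ¬ Splits S T × ¬ Splits T S

  Single : Subset n → Set
  Single S = Cutset2 S × ((T : Subset n) → Cutset2 T → T ≢ S → Independent S T)

  IsPart : Subset n → Set
  IsPart A = ((S : Subset n) → Single S → ¬ Splits S A) ×
    ((v : Fin n) → v ∉ A → Σ (Subset n) λ S → Single S × Separates S ⁅ v ⁆ A)

  Edge' : Fin n → Fin n → Set
  Edge' a b = E a b ⊎ Single (⁅ a ⁆ ∪ ⁅ b ⁆)

  IsBlock : Subset n → Set
  IsBlock A = IsPart A × KConnectedIn Edge' A 3

  ChoosableOn : Subset n → ℕ → Set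
  ChoosableOn U k = (L : Fin n → List ℕ) →
    (∀ v → v ∈ U → length (L v) ≡ k × Unique (L v)) →
    Σ (Fin n → ℕ) λ c →
      (∀ v → v ∈ U → c v ∈ˡ L v) ×
      (∀ u v → u ∈ U → v ∈ U → E u v → c u ≢ c v)

  IsChoiceNumber : Subset n → ℕ → Set
  IsChoiceNumber U k = ChoosableOn U k × ((j : ℕ) → ChoosableOn U j → k ≤ j)

{-# OPTIONS --safe #-}
module Submission where

open import Defs
open import Data.Bool using (true; if_then_else_) renaming (_≟_ to _≟ᵇ_)
open import Data.Empty using (⊥-elim)
open import Data.Fin using (Fin; zero; suc; toℕ; _≟_)
open import Data.Fin.Properties using (any?; all?; toℕ-injective)
open import Data.Fin.Subset
open import Data.Fin.Subset.Induction using (⊂-wellFounded; ⊃-wellFounded; Acc; acc)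
open import Data.Fin.Subset.Properties
open import Data.List using (List; []; _∷_; length; filter; take; upTo)
import Data.List as List
import Data.List.Membership.DecPropositional as DecMembership
open import Data.List.Membership.Propositional using () renaming (_∈_ to _∈ˡ_)
open import Data.List.Membership.Propositional.Properties using (∈-filter⁻; ∈-map⁻)
open import Data.List.Properties
  using (filter-accept; filter-reject; filter-all; length-take; length-upTo; length-map; map-∘; map-id-local)
import Data.List.Relation.Unary.All as All
import Data.List.Relation.Unary.All.Properties as All
import Data.List.Relation.Unary.AllPairs as AllPairs
open import Data.List.Relation.Unary.Any using (here)
import Data.List.Relation.Unary.Unique.DecPropositional as DecUnique
open import Data.List.Relation.Unary.Unique.Propositional using (Unique)
import Data.List.Relation.Unary.Unique.Propositional.Properties as Unique
open import Data.Nat using (ℕ; zero; suc; z≤n; s≤s; _≤_; _<_; _≤?_; _+_; _*_)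
import Data.Nat as ℕ
import Data.Nat.Properties as ℕ
open import Data.Product using (Σ; ∃; ∃₂; _×_; _,_; proj₁; proj₂)
open import Data.Sum using (_⊎_; inj₁; inj₂; [_,_]′; swap)
open import Data.Vec using (Vec; []; _∷_; lookup; tabulate; toList)
import Data.Vec as Vec
open import Data.Vec.Membership.Propositional using () renaming (_∈_ to _∈ᵛ_)
open import Data.Vec.Properties using (≡-dec; lookup∘tabulate; toList∘fromList; length-toList; toList-map)
import Data.Vec.Relation.Unary.Any as VecAny
import Data.Vec.Relation.Unary.Any.Properties as VecAny
open import Function using (_∘_; id)
open import Relation.Binary.PropositionalEquality using (_≡_; _≢_; refl; sym; trans; cong; subst; subst₂)
open import Relation.Nullary using (¬_; Dec; yes; no; does; contradiction)
open import Relation.Nullary.Decidable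
  using (map′; decidable-stable; dec-true; ¬?; _×-dec_; _⊎-dec_; _→-dec_)
open import Relation.Unary using (Decidable)

-- Let k = m + 2 bound the list sizes.  By induction on |U|, a colouring of at
-- most two vertices that no single cutset separates extends to U: if a single
-- cutset T splits U, colour one side, then extend the colouring of U ∩ T to the
-- other side, which works because single cutsets do not split one another.  If
-- no single cutset splits U, then U lies in a part A.  When G(A) is
-- a-choosable with a ≤ m, delete the at most two used colours from the lists.
-- When A is not a block, a cutset of G'(A) with at most two vertices is a
-- 2-cutset of G splitting A; cutting along crossing 2-cutsets then shows that
-- G(A) has maximum degree at most 2, so lists of size 3 can be coloured greedily.
-- Choosability is decidable (only n k colours matter), so choice numbers of
-- parts exist and the asserted parts can be found by search.

-- Subsets of a finite set

∈─⇒∉ : ∀ {n} (p q : Subset n) {x} → x ∈ p ─ q → x ∉ q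
∈─⇒∉ (s ∷ p) (outside ∷ q) Vec.here ()
∈─⇒∉ (s ∷ p) (t ∷ q) (Vec.there x∈) (Vec.there x∈q) = ∈─⇒∉ p q x∈ x∈q

∈∪ˡ : ∀ {n} {x : Fin n} {p q} → x ∈ p → x ∈ p ∪ q
∈∪ˡ = x∈p∪q⁺ ∘ inj₁

∈∪ʳ : ∀ {n} {x : Fin n} {p q} → x ∈ q → x ∈ p ∪ q
∈∪ʳ = x∈p∪q⁺ ∘ inj₂

p⊂p∪⁅x⁆ : ∀ {n} {p : Subset n} {x} → x ∉ p → p ⊂ p ∪ ⁅ x ⁆
p⊂p∪⁅x⁆ {x = x} x∉p = ∈∪ˡ , x , ∈∪ʳ (x∈⁅x⁆ x) , x∉p

∈pair⁻ : ∀ {n} {p q x : Fin n} → x ∈ ⁅ p ⁆ ∪ ⁅ q ⁆ → x ≡ p ⊎ x ≡ q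
∈pair⁻ {p = p} {q} x∈ with x∈p∪q⁻ ⁅ p ⁆ ⁅ q ⁆ x∈
... | inj₁ x∈p = inj₁ (x∈⁅y⁆⇒x≡y p x∈p)
... | inj₂ x∈q = inj₂ (x∈⁅y⁆⇒x≡y q x∈q)

∣p∪⁅x⁆∣≤1+∣p∣ : ∀ {n} (p : Subset n) x → ∣ p ∪ ⁅ x ⁆ ∣ ≤ suc ∣ p ∣
∣p∪⁅x⁆∣≤1+∣p∣ (outside ∷ p) zero rewrite ∪-identityʳ p = ℕ.≤-refl
∣p∪⁅x⁆∣≤1+∣p∣ (inside ∷ p) zero rewrite ∪-identityʳ p = ℕ.n≤1+n _
∣p∪⁅x⁆∣≤1+∣p∣ (outside ∷ p) (suc x) = ∣p∪⁅x⁆∣≤1+∣p∣ p x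
∣p∪⁅x⁆∣≤1+∣p∣ (inside ∷ p) (suc x) = s≤s (∣p∪⁅x⁆∣≤1+∣p∣ p x)

∣p∣≤1+∣p-x∣ : ∀ {n} (p : Subset n) x → ∣ p ∣ ≤ suc ∣ p - x ∣
∣p∣≤1+∣p-x∣ p x = ℕ.≤-trans (p⊆q⇒∣p∣≤∣q∣ p⊆) (∣p∪⁅x⁆∣≤1+∣p∣ (p - x) x)
  where
  p⊆ : p ⊆ (p - x) ∪ ⁅ x ⁆
  p⊆ {y} y∈p with y ≟ x
  ... | yes refl = ∈∪ʳ (x∈⁅x⁆ y)
  ... | no y≢x = ∈∪ˡ (x∈p∧x≢y⇒x∈p-y y∈p y≢x)

0<∣p∣⇒Nonempty : ∀ {n} (p : Subset n) → 0 < ∣ p ∣ → Nonempty p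
0<∣p∣⇒Nonempty {n} p 0<∣p∣ with nonempty? p
... | yes ne = ne
... | no ¬ne with refl ← Empty-unique ¬ne = contradiction 0<∣p∣ (ℕ.<-irrefl (sym (∣⊥∣≡0 n)))

x≢y⇒2≤∣p∣ : ∀ {n} {p : Subset n} {x y} → x ∈ p → y ∈ p → x ≢ y → 2 ≤ ∣ p ∣
x≢y⇒2≤∣p∣ x∈p y∈p x≢y =
  ℕ.≤-trans (s≤s (ℕ.≤-trans (s≤s z≤n) (x∈p⇒∣p-x∣<∣p∣ (x∈p∧x≢y⇒x∈p-y y∈p (x≢y ∘ sym))))) (x∈p⇒∣p-x∣<∣p∣ x∈p)

∣pair∣≡2 : ∀ {n} {x y : Fin n} → x ≢ y → ∣ ⁅ x ⁆ ∪ ⁅ y ⁆ ∣ ≡ 2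
∣pair∣≡2 {x = x} {y} x≢y = ℕ.≤-antisym
  (subst (λ k → ∣ ⁅ x ⁆ ∪ ⁅ y ⁆ ∣ ≤ suc k) (∣⁅x⁆∣≡1 x) (∣p∪⁅x⁆∣≤1+∣p∣ ⁅ x ⁆ y))
  (x≢y⇒2≤∣p∣ (∈∪ˡ (x∈⁅x⁆ x)) (∈∪ʳ (x∈⁅x⁆ y)) x≢y)

∣p∣≤2⇒∈pair : ∀ {n} {p : Subset n} {x y z} → ∣ p ∣ ≤ 2 →
              x ∈ p → y ∈ p → x ≢ y → z ∈ p → z ≡ x ⊎ z ≡ y
∣p∣≤2⇒∈pair {p = p} {x} {y} {z} ∣p∣≤2 x∈p y∈p x≢y z∈p with z ≟ x | z ≟ y
... | yes z≡x | _ = inj₁ z≡x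
... | no _ | yes z≡y = inj₂ z≡y
... | no z≢x | no z≢y = contradiction
  (ℕ.≤-<-trans (x≢y⇒2≤∣p∣ (∈- y∈p x≢y) (∈- z∈p (z≢x ∘ sym)) (z≢y ∘ sym)) (x∈p⇒∣p-x∣<∣p∣ x∈p))
  (ℕ.≤⇒≯ ∣p∣≤2)
  where
  ∈- : ∀ {w} → w ∈ p → x ≢ w → w ∈ p - x
  ∈- w∈p x≢w = x∈p∧x≢y⇒x∈p-y w∈p (x≢w ∘ sym)

∣p∣≤2⇒⊆pair : ∀ {n} {p : Subset n} → Fin n → ∣ p ∣ ≤ 2 → ∃₂ λ y z → ∀ {w} → w ∈ p → w ≡ y ⊎ w ≡ z
∣p∣≤2⇒⊆pair {p = p} x ∣p∣≤2 with nonempty? p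
... | no p=∅ = x , x , λ w∈p → ⊥-elim (p=∅ (_ , w∈p))
... | yes (y , y∈p) with nonempty? (p - y)
...   | yes (z , z∈p-y) = y , z , ∣p∣≤2⇒∈pair ∣p∣≤2 y∈p (p─q⊆p p ⁅ y ⁆ z∈p-y)
          λ { refl → ∈─⇒∉ p ⁅ y ⁆ z∈p-y (x∈⁅x⁆ y) }
...   | no p-y=∅ = y , y , λ {w} w∈p → inj₁ (decidable-stable (w ≟ y)
          λ w≢y → p-y=∅ (w , x∈p∧x≢y⇒x∈p-y w∈p w≢y))

∣p∣≡2⇒∈pair : ∀ {n} {p : Subset n} {x y z} → ∣ p ∣ ≡ 2 →
              x ∈ p → y ∈ p → x ≢ y → z ∈ p → z ≡ x ⊎ z ≡ y
∣p∣≡2⇒∈pair ∣p∣≡2 = ∣p∣≤2⇒∈pair (ℕ.≤-reflexive ∣p∣≡2)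

∣p∣≡2⇒elements : ∀ {n} {p : Subset n} → ∣ p ∣ ≡ 2 →
                 ∃₂ λ x y → x ∈ p × y ∈ p × x ≢ y × (∀ {z} → z ∈ p → z ≡ x ⊎ z ≡ y)
∣p∣≡2⇒elements {p = p} ∣p∣≡2 with 0<∣p∣⇒Nonempty p (subst (0 <_) (sym ∣p∣≡2) (s≤s z≤n))
... | x , x∈p with 0<∣p∣⇒Nonempty (p - x) (ℕ.≤-pred (subst (_≤ suc ∣ p - x ∣) ∣p∣≡2 (∣p∣≤1+∣p-x∣ p x)))
... | y , y∈p-x = x , y , x∈p , y∈p , x≢y , ∣p∣≡2⇒∈pair ∣p∣≡2 x∈p y∈p x≢y
  where
  y∈p : y ∈ p
  y∈p = p─q⊆p p ⁅ x ⁆ y∈p-x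
  x≢y : x ≢ y
  x≢y refl = ∈─⇒∉ p ⁅ x ⁆ y∈p-x (x∈⁅x⁆ x)

∣p∣≡2⇒≡pair : ∀ {n} {p : Subset n} {x y} → ∣ p ∣ ≡ 2 → x ∈ p → y ∈ p → x ≢ y → p ≡ ⁅ x ⁆ ∪ ⁅ y ⁆
∣p∣≡2⇒≡pair {p = p} {x} {y} ∣p∣≡2 x∈p y∈p x≢y = ⊆-antisym
  (λ z∈p → x∈p∪q⁺ ([ (λ { refl → inj₁ (x∈⁅x⁆ x) }) , (λ { refl → inj₂ (x∈⁅x⁆ y) }) ]′
                      (∣p∣≡2⇒∈pair ∣p∣≡2 x∈p y∈p x≢y z∈p)))
  ([ (λ { refl → x∈p }) , (λ { refl → y∈p }) ]′ ∘ ∈pair⁻)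

allSubset? : ∀ {n} {P : Subset n → Set} → Decidable P → Dec (∀ S → P S)
allSubset? P? = map′
  (λ ¬∃ S → decidable-stable (P? S) λ ¬p → ¬∃ (S , ¬p))
  (λ ∀p (S , ¬p) → ¬p (∀p S))
  (¬? (anySubset? (¬? ∘ P?)))

-- Walks and components

module _ {n : ℕ} {E : Fin n → Fin n → Set} where

  walk-source : ∀ {X x y} → Walk E X x y → x ∈ X
  walk-source (here x∈X) = x∈X
  walk-source (step x∈X _ _) = x∈X

  walk-target : ∀ {X x y} → Walk E X x y → y ∈ X
  walk-target (here x∈X) = x∈X
  walk-target (step _ _ w) = walk-target w

  walk-trans : ∀ {X x y z} → Walk E X x y → Walk E X y z → Walk E X x z
  walk-trans (here _) w = w
  walk-trans (step x∈X e v) w = step x∈X e (walk-trans v w)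

  walk-snoc : ∀ {X x y z} → Walk E X x y → E y z → z ∈ X → Walk E X x z
  walk-snoc w e z∈X = walk-trans w (step (walk-target w) e (here z∈X))

  walk-mono : ∀ {X Y x y} → X ⊆ Y → Walk E X x y → Walk E Y x y
  walk-mono X⊆Y (here x∈X) = here (X⊆Y x∈X)
  walk-mono X⊆Y (step x∈X e w) = step (X⊆Y x∈X) e (walk-mono X⊆Y w)

  walk-sym : (∀ {u v} → E u v → E v u) → ∀ {X x y} → Walk E X x y → Walk E X y x
  walk-sym E-sym (here x∈X) = here x∈X
  walk-sym E-sym (step x∈X e w) = walk-snoc (walk-sym E-sym w) (E-sym e) x∈X

  -- Each vertex of the walk is reached from `x` by an initial segment of it, hence lies in `Y`.
  walk-reachable : ∀ {X Y x y} → Walk E X x y → (∀ {z} → Walk E X x z → z ∈ Y) → Walk E Y x y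
  walk-reachable (here x∈X) r = here (r (here x∈X))
  walk-reachable (step x∈X e w) r =
    step (r (here x∈X)) e (walk-reachable w (λ v → r (step x∈X e v)))

  walk-closed : ∀ {X x y} (C : Subset n) → (∀ {u v} → u ∈ C → v ∈ X → E u v → v ∈ C) →
                Walk E X x y → x ∈ C → y ∈ C
  walk-closed C closed (here _) x∈C = x∈C
  walk-closed C closed (step _ e w) x∈C = walk-closed C closed w (closed x∈C (walk-source w) e)

  module _ (E? : ∀ u v → Dec (E u v)) where

    -- Starting from `⁅ x ⁆`, neighbours in `X` are added one at a time. A set that can no longer
    -- grow is closed under edges within `X`, so no walk leaves it.
    component : ∀ {X x} → x ∈ X →
                ∃ λ C → (∀ {y} → y ∈ C → Walk E X x y) × (∀ {y} → Walk E X x y → y ∈ C)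
    component {X} {x} x∈X = grow ⁅ x ⁆ (⊃-wellFounded _) (x∈⁅x⁆ x)
      λ y∈x → subst (Walk E X x) (sym (x∈⁅y⁆⇒x≡y x y∈x)) (here x∈X)
      where
      grow : ∀ C → Acc _⊃_ C → x ∈ C → (∀ {y} → y ∈ C → Walk E X x y) →
             ∃ λ C → (∀ {y} → y ∈ C → Walk E X x y) × (∀ {y} → Walk E X x y → y ∈ C)
      grow C (acc rs) x∈C sound
        with any? (λ u → any? λ v → u ∈? C ×-dec v ∈? X ×-dec E? u v ×-dec ¬? (v ∈? C))
      ... | yes (u , v , u∈C , v∈X , e , v∉C) =
        grow (C ∪ ⁅ v ⁆) (rs (p⊂p∪⁅x⁆ v∉C)) (∈∪ˡ x∈C)
          λ y∈ → [ sound , (λ y∈v → subst (Walk E X x) (sym (x∈⁅y⁆⇒x≡y v y∈v)) (walk-snoc (sound u∈C) e v∈X)) ]′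
                   (x∈p∪q⁻ C ⁅ v ⁆ y∈)
      ... | no ¬∃ = C , sound , λ w → walk-closed C
        (λ {u} {v} u∈C v∈X e → decidable-stable (v ∈? C) λ v∉C → ¬∃ (u , v , u∈C , v∈X , e , v∉C)) w x∈C

    walk? : ∀ X x y → Dec (Walk E X x y)
    walk? X x y with x ∈? X
    ... | no x∉X = no (x∉X ∘ walk-source)
    ... | yes x∈X with component x∈X
    ... | C , sound , complete = map′ sound complete (y ∈? C)

    disconnected? : ∀ X → Dec (Disconnected E X)
    disconnected? X = any? λ x → any? λ y → x ∈? X ×-dec y ∈? X ×-dec ¬? (walk? X x y)

    cutsetIn? : ∀ U R → Dec (CutsetIn E U R)
    cutsetIn? U R = R ⊆? U ×-dec disconnected? (U ─ R)

    kConnectedIn? : ∀ U k → Dec (KConnectedIn E U k)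
    kConnectedIn? U k = k ℕ.<? ∣ U ∣ ×-dec allSubset? λ R → cutsetIn? U R →-dec k ℕ.≤? ∣ R ∣

-- Decidability of cutsets, parts and blocks; sets that no single cutset splits

module _ {n : ℕ} (G : Graph n) where

  private
    E = Edge G

  edge? : ∀ u v → Dec (E u v)
  edge? u v = Graph.adj G u v ≟ᵇ true

  edge-sym : ∀ {u v} → E u v → E v u
  edge-sym {u} {v} e = trans (sym (Graph.symm G u v)) e

  _≟ˢ_ : (S T : Subset n) → Dec (S ≡ T)
  _≟ˢ_ = ≡-dec _≟ᵇ_

  conn? : ∀ S x y → Dec (Walk E (∁ S) x y)
  conn? S = walk? edge? (∁ S)

  conn-sym : ∀ {S x y} → Walk E (∁ S) x y → Walk E (∁ S) y x
  conn-sym = walk-sym edge-sym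

  cutset2? : ∀ S → Dec (Cutset2 G S)
  cutset2? S = cutsetIn? edge? ⊤ S ×-dec ∣ S ∣ ℕ.≟ 2

  splits? : ∀ S X → Dec (Splits G S X)
  splits? S X = any? λ x → any? λ y →
    x ∈? X ×-dec ¬? (x ∈? S) ×-dec y ∈? X ×-dec ¬? (y ∈? S) ×-dec ¬? (conn? S x y)

  single? : ∀ S → Dec (Single G S)
  single? S = cutset2? S ×-dec allSubset? λ T →
    cutset2? T →-dec ¬? (T ≟ˢ S) →-dec ¬? (splits? S T) ×-dec ¬? (splits? T S)

  separates? : ∀ S X Y → Dec (Separates G S X Y)
  separates? S X Y = ¬? (X ⊆? S) ×-dec ¬? (Y ⊆? S) ×-dec
    all? λ x → all? λ y → x ∈? X →-dec ¬? (x ∈? S) →-dec y ∈? Y →-dec ¬? (y ∈? S) →-dec ¬? (conn? S x y)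

  part? : ∀ A → Dec (IsPart G A)
  part? A = (allSubset? λ S → single? S →-dec ¬? (splits? S A)) ×-dec
    all? λ v → ¬? (v ∈? A) →-dec anySubset? λ S → single? S ×-dec separates? S ⁅ v ⁆ A

  edge'? : ∀ u v → Dec (Edge' G u v)
  edge'? u v = edge? u v ⊎-dec single? (⁅ u ⁆ ∪ ⁅ v ⁆)

  block? : ∀ A → Dec (IsBlock G A)
  block? A = part? A ×-dec kConnectedIn? edge'? A 3

  -- `Cutset` deletes `S` as `⊤ ─ S`, whereas splitting and separation use `∁ S`; this lemma and the
  -- next pass between the two forms.
  ¬conn⇒Cutset : ∀ {S x y} → x ∉ S → y ∉ S → ¬ Walk E (∁ S) x y → Cutset G S
  ¬conn⇒Cutset {S} {x} {y} x∉S y∉S ¬xy =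
    ⊆⊤ , x , y , x∈p∧x∉q⇒x∈p─q ∈⊤ x∉S , x∈p∧x∉q⇒x∈p─q ∈⊤ y∉S ,
    ¬xy ∘ walk-mono (x∉p⇒x∈∁p ∘ ∈─⇒∉ ⊤ S)

  Cutset⇒¬conn : ∀ {S} → Cutset G S → ∃₂ λ x y → x ∉ S × y ∉ S × ¬ Walk E (∁ S) x y
  Cutset⇒¬conn {S} (_ , x , y , x∈ , y∈ , ¬xy) = x , y , ∈─⇒∉ ⊤ S x∈ , ∈─⇒∉ ⊤ S y∈ ,
    ¬xy ∘ walk-mono (x∈p∧x∉q⇒x∈p─q ∈⊤ ∘ x∈∁p⇒x∉p)

  -- The first condition of `IsPart` on its own: the precoloured sets in the induction satisfy it
  -- but need not be parts.
  Unsplit : Subset n → Set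
  Unsplit A = ∀ S → Single G S → ¬ Splits G S A

  unsplit-conn : ∀ {A S x y} → Unsplit A → Single G S →
                 x ∈ A → x ∉ S → y ∈ A → y ∉ S → Walk E (∁ S) x y
  unsplit-conn {S = S} {x} {y} unsplit single x∈A x∉S y∈A y∉S =
    decidable-stable (conn? S x y) λ ¬xy → unsplit S single (x , y , x∈A , x∉S , y∈A , y∉S , ¬xy)

  splits-mono : ∀ {S X Y} → X ⊆ Y → Splits G S X → Splits G S Y
  splits-mono X⊆Y (x , y , x∈X , x∉S , y∈X , rest) = x , y , X⊆Y x∈X , x∉S , X⊆Y y∈X , rest

  -- Distinct single cutsets are independent, and a cutset cannot split itself because splitting
  -- needs vertices outside it.
  single-unsplit : ∀ {S} → Single G S → Unsplit S
  single-unsplit {S} (cutset , _) T (_ , indep) split with S ≟ˢ T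
  ... | yes refl = let x , _ , x∈S , x∉S , _ = split in x∉S x∈S
  ... | no S≢T = proj₁ (indep S cutset S≢T) split

  -- Vertices are added as long as no single cutset splits the result. At a maximal set `U`, each
  -- outside vertex `v` has a single cutset splitting `U ∪ ⁅ v ⁆`; it does not split `U`, so it
  -- separates `v` from `U`.
  unsplit⊆part : ∀ {U} → Unsplit U → ∃ λ A → IsPart G A × U ⊆ A
  unsplit⊆part {U} = extend U (⊃-wellFounded U)
    where
    extend : ∀ U → Acc _⊃_ U → Unsplit U → ∃ λ A → IsPart G A × U ⊆ A
    extend U (acc rs) unsplit
      with any? (λ v → ¬? (v ∈? U) ×-dec allSubset? λ S → single? S →-dec ¬? (splits? S (U ∪ ⁅ v ⁆)))
    ... | yes (v , v∉U , unsplit′) with extend (U ∪ ⁅ v ⁆) (rs (p⊂p∪⁅x⁆ v∉U)) unsplit′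
    ...   | A , part , U∪v⊆A = A , part , U∪v⊆A ∘ ∈∪ˡ
    extend U (acc rs) unsplit | no maximal = U , (unsplit , separate) , id
      where
      separate : ∀ v → v ∉ U → ∃ λ S → Single G S × Separates G S ⁅ v ⁆ U
      separate v v∉U with anySubset? (λ S → single? S ×-dec splits? S (U ∪ ⁅ v ⁆))
      ... | no ¬∃ = contradiction (v , v∉U , λ S single split → ¬∃ (S , single , split)) maximal
      ... | yes (S , single , x , y , x∈ , x∉S , y∈ , y∉S , ¬xy)
        = S , single , by-cases (x∈p∪q⁻ U ⁅ v ⁆ x∈) (x∈p∪q⁻ U ⁅ v ⁆ y∈)
        where
        separated : ∀ {y} → v ∉ S → y ∈ U → y ∉ S → ¬ Walk E (∁ S) v y → Separates G S ⁅ v ⁆ U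
        separated {y} v∉S y∈U y∉S ¬vy = (λ v⊆S → v∉S (v⊆S (x∈⁅x⁆ v))) , (λ U⊆S → y∉S (U⊆S y∈U)) , sep
          where
          sep : ∀ x z → x ∈ ⁅ v ⁆ → x ∉ S → z ∈ U → z ∉ S → ¬ Walk E (∁ S) x z
          sep x z x∈v _ z∈U z∉S xz with refl ← x∈⁅y⁆⇒x≡y v x∈v =
            ¬vy (walk-trans xz (unsplit-conn unsplit single z∈U z∉S y∈U y∉S))
        by-cases : x ∈ U ⊎ x ∈ ⁅ v ⁆ → y ∈ U ⊎ y ∈ ⁅ v ⁆ → Separates G S ⁅ v ⁆ U
        by-cases (inj₁ x∈U) (inj₁ y∈U) = contradiction (unsplit-conn unsplit single x∈U x∉S y∈U y∉S) ¬xy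
        by-cases (inj₁ x∈U) (inj₂ y∈v) with refl ← x∈⁅y⁆⇒x≡y v y∈v = separated y∉S x∈U x∉S (¬xy ∘ conn-sym)
        by-cases (inj₂ x∈v) (inj₁ y∈U) with refl ← x∈⁅y⁆⇒x≡y v x∈v = separated x∉S y∈U y∉S ¬xy
        by-cases (inj₂ x∈v) (inj₂ y∈v) with refl ← x∈⁅y⁆⇒x≡y v x∈v | refl ← x∈⁅y⁆⇒x≡y v y∈v =
          contradiction (here (x∉p⇒x∈∁p x∉S)) ¬xy

-- Neighbours within a part split by a 2-cutset

module _ {n : ℕ} (G : Graph n) where

  private
    E = Edge G

  -- The witnesses may coincide and need not be neighbours, so smaller degrees are covered.
  AtMostTwoNeighbours : Subset n → Fin n → Set
  AtMostTwoNeighbours A x = ∃₂ λ y z → ∀ {w} → w ∈ A → E x w → w ≡ y ⊎ w ≡ z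

  AtMostOneNeighbour : Subset n → Fin n → (Fin n → Set) → Set
  AtMostOneNeighbour A x X = ∃ λ y → ∀ {w} → w ∈ A → E x w → X w → w ≡ y

  -- The ends count only neighbours inside the piece, the opposite end included, so that two pieces
  -- sharing an end give it at most two.
  PieceNeighbours : (A I : Subset n) (p q : Fin n) → Set
  PieceNeighbours A I p q =
    AtMostOneNeighbour A p (λ w → w ∈ I ⊎ w ≡ q) ×
    AtMostOneNeighbour A q (λ w → w ∈ I ⊎ w ≡ p) ×
    (∀ {x} → x ∈ I → AtMostTwoNeighbours A x)

module _ {n : ℕ} (G : Graph n) (biconnected : Biconnected G) where

  private
    E = Edge G

  ¬conn⇒2≤∣S∣ : ∀ {S x y} → x ∉ S → y ∉ S → ¬ Walk E (∁ S) x y → 2 ≤ ∣ S ∣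
  ¬conn⇒2≤∣S∣ {S} x∉S y∉S ¬xy = proj₂ biconnected S (¬conn⇒Cutset G x∉S y∉S ¬xy)

  -- Otherwise S - s would be a one-vertex cutset.
  attach : ∀ {S X s z} → ∣ S ∣ ≡ 2 → s ∈ S → z ∉ S → s ∈ X →
           (∀ {y} → Walk E (∁ S) z y → y ∈ X) → Walk E X s z
  attach {S} {X} {s} {z} ∣S∣≡2 s∈S z∉S s∈X z⇝⊆X with conn? G (S - s) z s
  ... | no ¬zs = contradiction
    (ℕ.≤-<-trans (¬conn⇒2≤∣S∣ (z∉S ∘ p─q⊆p S ⁅ s ⁆) (λ s∈ → ∈─⇒∉ S ⁅ s ⁆ s∈ (x∈⁅x⁆ s)) ¬zs) (x∈p⇒∣p-x∣<∣p∣ s∈S))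
    (ℕ.<-irrefl (sym ∣S∣≡2))
  ... | yes zs = walk-sym (edge-sym G) (go zs (here (x∉p⇒x∈∁p z∉S)))
    where
    go : ∀ {u} → Walk E (∁ (S - s)) u s → Walk E (∁ S) z u → Walk E X u s
    go (here _) zu = contradiction s∈S (x∈∁p⇒x∉p (walk-target zu))
    go (step {w = w} _ e ws) zu with w ≟ s
    ... | yes refl = step (z⇝⊆X zu) e (here s∈X)
    ... | no w≢s = step (z⇝⊆X zu) e (go ws (walk-snoc zu e
      (x∉p⇒x∈∁p λ w∈S → x∈∁p⇒x∉p (walk-source ws) (x∈p∧x≢y⇒x∈p-y w∈S w≢s))))

  -- If no 2-cutset separates `p` from `q`, then none splits the pair, and the pair splits none
  -- either; it would therefore be single.
  crossing-cutset : ∀ {p q} → Cutset2 G (⁅ p ⁆ ∪ ⁅ q ⁆) → ¬ Single G (⁅ p ⁆ ∪ ⁅ q ⁆) →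
                    ∃ λ T → Cutset2 G T × p ∉ T × q ∉ T × ¬ Walk E (∁ T) p q
  crossing-cutset {p} {q} cutset ¬single
    with anySubset? (λ T → cutset2? G T ×-dec ¬? (p ∈? T) ×-dec ¬? (q ∈? T) ×-dec ¬? (conn? G T p q))
  ... | yes crossing = crossing
  ... | no ¬crossing = contradiction (cutset , λ T cutset-T _ → ¬S-splits T cutset-T , ¬T-splits T cutset-T) ¬single
    where
    S = ⁅ p ⁆ ∪ ⁅ q ⁆

    connected : ∀ {T} → Cutset2 G T → p ∉ T → q ∉ T → Walk E (∁ T) p q
    connected {T} cutset-T p∉T q∉T = decidable-stable (conn? G T p q)
      λ ¬pq → ¬crossing (T , cutset-T , p∉T , q∉T , ¬pq)

    ¬T-splits : ∀ T → Cutset2 G T → ¬ Splits G T S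
    ¬T-splits T cutset-T (x , y , x∈S , x∉T , y∈S , y∉T , ¬xy) with ∈pair⁻ x∈S | ∈pair⁻ y∈S
    ... | inj₁ refl | inj₁ refl = ¬xy (here (x∉p⇒x∈∁p x∉T))
    ... | inj₂ refl | inj₂ refl = ¬xy (here (x∉p⇒x∈∁p x∉T))
    ... | inj₁ refl | inj₂ refl = ¬xy (connected cutset-T x∉T y∉T)
    ... | inj₂ refl | inj₁ refl = ¬xy (conn-sym G (connected cutset-T y∉T x∉T))

    -- If T does not separate p from q, some component of G − T avoids S, and
    -- any two vertices of T are joined through it.
    ¬S-splits : ∀ T → Cutset2 G T → ¬ Splits G S T
    ¬S-splits T cutset-T@(cut , ∣T∣≡2) (x , y , x∈T , x∉S , y∈T , y∉S , ¬xy) = joined away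
      where
      x≢y : x ≢ y
      x≢y refl = ¬xy (here (x∉p⇒x∈∁p x∉S))
      T∩S=∅ : ∀ {z} → z ∈ S → z ∉ T
      T∩S=∅ z∈S z∈T with ∣p∣≡2⇒∈pair ∣T∣≡2 x∈T y∈T x≢y z∈T
      ... | inj₁ refl = x∉S z∈S
      ... | inj₂ refl = y∉S z∈S
      p∉T : p ∉ T
      p∉T = T∩S=∅ (∈∪ˡ (x∈⁅x⁆ p))
      q∉T : q ∉ T
      q∉T = T∩S=∅ (∈∪ʳ (x∈⁅x⁆ q))
      away : ∃ λ z → z ∉ T × ¬ Walk E (∁ T) p z
      away with Cutset⇒¬conn G cut
      ... | u , v , u∉T , v∉T , ¬uv with conn? G T p u
      ... | no ¬pu = u , u∉T , ¬pu
      ... | yes pu = v , v∉T , λ pv → ¬uv (walk-trans (conn-sym G pu) pv)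
      joined : ¬ ∃ λ z → z ∉ T × ¬ Walk E (∁ T) p z
      joined (z , z∉T , ¬pz) = ¬xy (walk-trans (via x∈T x∉S) (conn-sym G (via y∈T y∉S)))
        where
        z⇝∉S : ∀ {w} → Walk E (∁ T) z w → w ∉ S
        z⇝∉S zw w∈S with ∈pair⁻ w∈S
        ... | inj₁ refl = ¬pz (conn-sym G zw)
        ... | inj₂ refl = ¬pz (walk-trans (connected cutset-T p∉T q∉T) (conn-sym G zw))
        via : ∀ {x} → x ∈ T → x ∉ S → Walk E (∁ S) x z
        via x∈T x∉S = attach ∣T∣≡2 x∈T z∉T (x∉p⇒x∈∁p x∉S) (x∉p⇒x∈∁p ∘ z⇝∉S)

  -- I is a piece with ends p and q.  If it meets A, then {p, q} is a cutset
  -- splitting A, hence not single, and a crossing cutset yields a vertex e of I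
  -- cutting I into smaller pieces with ends p, e and e, q.
  piece-neighbours : ∀ {A b} → Unsplit G A → b ∈ A →
    ∀ I → Acc _⊂_ I → ∀ {p q} → p ≢ q → p ∉ I → q ∉ I → b ∉ I → b ≢ p → b ≢ q →
    (∀ {u w} → u ∈ I → E u w → w ∈ I ⊎ w ≡ p ⊎ w ≡ q) →
    PieceNeighbours G A I p q
  piece-neighbours {A} {b} unsplit b∈A I (acc rs) {p} {q} p≢q p∉I q∉I b∉I b≢p b≢q closed
    with nonempty? (A ∩ I)
  ... | no A∩I=∅ =
    (q , λ w∈A _ → [ (λ w∈I → ⊥-elim (A∩I=∅ (_ , x∈p∩q⁺ (w∈A , w∈I)))) , id ]′) ,
    (p , λ w∈A _ → [ (λ w∈I → ⊥-elim (A∩I=∅ (_ , x∈p∩q⁺ (w∈A , w∈I)))) , id ]′) ,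
    λ x∈I → p , q , λ w∈A e → [ (λ w∈I → ⊥-elim (A∩I=∅ (_ , x∈p∩q⁺ (w∈A , w∈I)))) , id ]′ (closed x∈I e)
  ... | yes (a , a∈A∩I) = subdivide (crossing-cutset (¬conn⇒Cutset G a∉S b∉S ¬ab , ∣S∣≡2) ¬single)
    where
    a∈A : a ∈ A
    a∈A = proj₁ (x∈p∩q⁻ A I a∈A∩I)
    a∈I : a ∈ I
    a∈I = proj₂ (x∈p∩q⁻ A I a∈A∩I)
    S = ⁅ p ⁆ ∪ ⁅ q ⁆
    p∈S : p ∈ S
    p∈S = ∈∪ˡ (x∈⁅x⁆ p)
    q∈S : q ∈ S
    q∈S = ∈∪ʳ (x∈⁅x⁆ q)
    ∣S∣≡2 : ∣ S ∣ ≡ 2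
    ∣S∣≡2 = ∣pair∣≡2 p≢q
    I∩S=∅ : ∀ {x} → x ∈ I → x ∉ S
    I∩S=∅ x∈I x∈S with ∈pair⁻ x∈S
    ... | inj₁ refl = p∉I x∈I
    ... | inj₂ refl = q∉I x∈I
    closed′ : ∀ {u w} → u ∈ I → w ∈ ∁ S → E u w → w ∈ I
    closed′ u∈I w∈∁S e with closed u∈I e
    ... | inj₁ w∈I = w∈I
    ... | inj₂ (inj₁ refl) = contradiction p∈S (x∈∁p⇒x∉p w∈∁S)
    ... | inj₂ (inj₂ refl) = contradiction q∈S (x∈∁p⇒x∉p w∈∁S)
    stay : ∀ {x y} → Walk E (∁ S) x y → x ∈ I → y ∈ I
    stay = walk-closed I closed′
    a∉S : a ∉ S
    a∉S = I∩S=∅ a∈I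
    b∉S : b ∉ S
    b∉S b∈S = [ b≢p , b≢q ]′ (∈pair⁻ b∈S)
    ¬ab : ¬ Walk E (∁ S) a b
    ¬ab ab = b∉I (stay ab a∈I)
    ¬single : ¬ Single G S
    ¬single single = unsplit S single (a , b , a∈A , a∉S , b∈A , b∉S , ¬ab)

    subdivide : (∃ λ T → Cutset2 G T × p ∉ T × q ∉ T × ¬ Walk E (∁ T) p q) →
      PieceNeighbours G A I p q
    subdivide (T , (cut-T , ∣T∣≡2) , p∉T , q∉T , ¬pq) =
      divide meets-I meets-J (component (edge? G) (x∉p⇒x∈∁p p∉T))
      where
      -- If the component of `z` in G - S missed `T`, both `p` and `q` would attach to it and be
      -- joined outside `T`.
      T-meets : ∀ {z} → z ∉ S → ¬ (∀ {y} → Walk E (∁ S) z y → y ∉ T)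
      T-meets z∉S avoid = ¬pq (walk-trans
        (attach ∣S∣≡2 p∈S z∉S (x∉p⇒x∈∁p p∉T) (x∉p⇒x∈∁p ∘ avoid))
        (conn-sym G (attach ∣S∣≡2 q∈S z∉S (x∉p⇒x∈∁p q∉T) (x∉p⇒x∈∁p ∘ avoid))))

      -- The component of `a` lies in `I` and that of `b` outside it, so `T` has exactly one vertex
      -- in `I` and one outside.
      meets-I : ∃ λ e → e ∈ I × e ∈ T
      meets-I = decidable-stable (any? λ e → e ∈? I ×-dec e ∈? T)
        λ ¬∃ → T-meets a∉S λ ay y∈T → ¬∃ (_ , stay ay a∈I , y∈T)
      meets-J : ∃ λ f → f ∉ I × f ∈ T
      meets-J = decidable-stable (any? λ f → ¬? (f ∈? I) ×-dec f ∈? T)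
        λ ¬∃ → T-meets b∉S λ by y∈T → ¬∃ (_ , (λ y∈I → b∉I (stay (conn-sym G by) y∈I)) , y∈T)

      divide : (∃ λ e → e ∈ I × e ∈ T) → (∃ λ f → f ∉ I × f ∈ T) →
        (∃ λ C → (∀ {y} → y ∈ C → Walk E (∁ T) p y) × (∀ {y} → Walk E (∁ T) p y → y ∈ C)) →
        PieceNeighbours G A I p q
      divide (e , e∈I , e∈T) (f , f∉I , f∈T) (C , C-sound , C-complete) = at-p , at-q , inside-I
        where
        ∈I⇒∉T : ∀ {w} → w ∈ I → w ≢ e → w ∉ T
        ∈I⇒∉T w∈I w≢e w∈T with ∣p∣≡2⇒∈pair ∣T∣≡2 e∈T f∈T (λ { refl → f∉I e∈I }) w∈T
        ... | inj₁ w≡e = w≢e w≡e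
        ... | inj₂ refl = f∉I w∈I

        C-step : ∀ {u w} → u ∈ C → E u w → w ∉ T → w ∈ C
        C-step u∈C e w∉T = C-complete (walk-snoc (C-sound u∈C) e (x∉p⇒x∈∁p w∉T))
        p∈C : p ∈ C
        p∈C = C-complete (here (x∉p⇒x∈∁p p∉T))
        q∉C : q ∉ C
        q∉C = ¬pq ∘ C-sound
        e∉C : e ∉ C
        e∉C e∈C = x∈∁p⇒x∉p (walk-target (C-sound e∈C)) e∈T

        -- `I₁` collects the vertices of `I` on the side of `p` in G - T, `I₂` all others except
        -- `e`. No edge joins `I₁` to `I₂`, since `T` meets `I` only in `e`.
        I₁ = I ∩ C
        I₂ = (I ─ C) - e
        ∈I₁⁻ : ∀ {x} → x ∈ I₁ → x ∈ I × x ∈ C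
        ∈I₁⁻ = x∈p∩q⁻ I C
        ∈I₂⁺ : ∀ {x} → x ∈ I → x ∉ C → x ≢ e → x ∈ I₂
        ∈I₂⁺ x∈I x∉C x≢e = x∈p∧x≢y⇒x∈p-y (x∈p∧x∉q⇒x∈p─q x∈I x∉C) x≢e
        ∈I₂⁻ : ∀ {x} → x ∈ I₂ → x ∈ I × x ∉ C × x ≢ e
        ∈I₂⁻ x∈ = p─q⊆p I C x∈─ , ∈─⇒∉ I C x∈─ , λ { refl → ∈─⇒∉ (I ─ C) ⁅ e ⁆ x∈ (x∈⁅x⁆ e) }
          where x∈─ = p─q⊆p (I ─ C) ⁅ e ⁆ x∈
        ¬e∈I₂ : e ∉ I₂
        ¬e∈I₂ e∈ = proj₂ (proj₂ (∈I₂⁻ e∈)) refl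

        closed₁ : ∀ {u w} → u ∈ I₁ → E u w → w ∈ I₁ ⊎ w ≡ p ⊎ w ≡ e
        closed₁ {w = w} u∈I₁ uw with ∈I₁⁻ u∈I₁
        ... | u∈I , u∈C with closed u∈I uw
        ... | inj₂ (inj₁ w≡p) = inj₂ (inj₁ w≡p)
        ... | inj₂ (inj₂ refl) = contradiction (C-step u∈C uw q∉T) q∉C
        ... | inj₁ w∈I with w ≟ e
        ...   | yes w≡e = inj₂ (inj₂ w≡e)
        ...   | no w≢e = inj₁ (x∈p∩q⁺ (w∈I , C-step u∈C uw (∈I⇒∉T w∈I w≢e)))

        closed₂ : ∀ {u w} → u ∈ I₂ → E u w → w ∈ I₂ ⊎ w ≡ e ⊎ w ≡ q
        closed₂ {w = w} u∈I₂ uw with ∈I₂⁻ u∈I₂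
        ... | u∈I , u∉C , u≢e with closed u∈I uw
        ... | inj₂ (inj₁ refl) = contradiction (C-step p∈C (edge-sym G uw) (∈I⇒∉T u∈I u≢e)) u∉C
        ... | inj₂ (inj₂ w≡q) = inj₂ (inj₂ w≡q)
        ... | inj₁ w∈I with w ≟ e
        ...   | yes w≡e = inj₂ (inj₁ w≡e)
        ...   | no w≢e = inj₁ (∈I₂⁺ w∈I
          (λ w∈C → u∉C (C-step w∈C (edge-sym G uw) (∈I⇒∉T u∈I u≢e))) w≢e)

        rec₁ = piece-neighbours unsplit b∈A I₁
          (rs ((proj₁ ∘ ∈I₁⁻) , e , e∈I , e∉C ∘ proj₂ ∘ ∈I₁⁻))
          {p} {e} (λ { refl → p∉I e∈I }) (p∉I ∘ proj₁ ∘ ∈I₁⁻) (e∉C ∘ proj₂ ∘ ∈I₁⁻)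
          (b∉I ∘ proj₁ ∘ ∈I₁⁻) b≢p (λ { refl → b∉I e∈I }) closed₁
        rec₂ = piece-neighbours unsplit b∈A I₂
          (rs ((proj₁ ∘ ∈I₂⁻) , e , e∈I , ¬e∈I₂))
          {e} {q} (λ { refl → q∉I e∈I }) ¬e∈I₂ (q∉I ∘ proj₁ ∘ ∈I₂⁻)
          (b∉I ∘ proj₁ ∘ ∈I₂⁻) (λ { refl → b∉I e∈I }) b≢q closed₂

        at-p : AtMostOneNeighbour G A p (λ w → w ∈ I ⊎ w ≡ q)
        at-p with proj₁ rec₁
        ... | y , unique = y , λ w∈A pw w∈ → unique w∈A pw (locate pw w∈)
          where
          locate : ∀ {w} → E p w → w ∈ I ⊎ w ≡ q → w ∈ I₁ ⊎ w ≡ e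
          locate pw (inj₂ refl) = contradiction (C-step p∈C pw q∉T) q∉C
          locate {w} pw (inj₁ w∈I) with w ≟ e
          ... | yes w≡e = inj₂ w≡e
          ... | no w≢e = inj₁ (x∈p∩q⁺ (w∈I , C-step p∈C pw (∈I⇒∉T w∈I w≢e)))

        at-q : AtMostOneNeighbour G A q (λ w → w ∈ I ⊎ w ≡ p)
        at-q with proj₁ (proj₂ rec₂)
        ... | y , unique = y , λ w∈A qw w∈ → unique w∈A qw (locate qw w∈)
          where
          locate : ∀ {w} → E q w → w ∈ I ⊎ w ≡ p → w ∈ I₂ ⊎ w ≡ e
          locate qw (inj₂ refl) = contradiction (C-step p∈C (edge-sym G qw) q∉T) q∉C
          locate {w} qw (inj₁ w∈I) with w ≟ e
          ... | yes w≡e = inj₂ w≡e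
          ... | no w≢e = inj₁ (∈I₂⁺ w∈I (λ w∈C → q∉C (C-step w∈C (edge-sym G qw) q∉T)) w≢e)

        -- As a common end of both smaller pieces, `e` has at most one neighbour in each; `p` counts
        -- with the first piece and `q` with the second.
        at-e : AtMostTwoNeighbours G A e
        at-e with proj₁ (proj₂ rec₁) | proj₁ rec₂
        ... | y , unique-y | z , unique-z = y , z , λ {w} w∈A ew → side w∈A ew (closed e∈I ew)
          where
          side : ∀ {w} → w ∈ A → E e w → w ∈ I ⊎ w ≡ p ⊎ w ≡ q → w ≡ y ⊎ w ≡ z
          side w∈A ew (inj₂ (inj₁ w≡p)) = inj₁ (unique-y w∈A ew (inj₂ w≡p))
          side w∈A ew (inj₂ (inj₂ w≡q)) = inj₂ (unique-z w∈A ew (inj₂ w≡q))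
          side {w} w∈A ew (inj₁ w∈I) with w ∈? C
          ... | yes w∈C = inj₁ (unique-y w∈A ew (inj₁ (x∈p∩q⁺ (w∈I , w∈C))))
          ... | no w∉C = inj₂ (unique-z w∈A ew (inj₁ (∈I₂⁺ w∈I w∉C λ { refl → Graph.noLoop G w ew })))

        inside-I : ∀ {x} → x ∈ I → AtMostTwoNeighbours G A x
        inside-I {x} x∈I with x ≟ e | x ∈? C
        ... | yes refl | _ = at-e
        ... | no _ | yes x∈C = proj₂ (proj₂ rec₁) (x∈p∩q⁺ (x∈I , x∈C))
        ... | no x≢e | no x∉C = proj₂ (proj₂ rec₂) (∈I₂⁺ x∈I x∉C x≢e)

  -- The component `I` of `a` in G - S and the remainder `J` are both pieces with ends `p` and `q`;
  -- the vertex of `A` outside the piece is `b` for `I` and `a` for `J`. A vertex of `S` has at most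
  -- one neighbour on each side.
  split-neighbours : ∀ {A S} → Unsplit G A → Cutset2 G S → Splits G S A → ∀ x → AtMostTwoNeighbours G A x
  split-neighbours {A} {S} unsplit (_ , ∣S∣≡2) (a , b , a∈A , a∉S , b∈A , b∉S , ¬ab) x
    with ∣p∣≡2⇒elements ∣S∣≡2 | component (edge? G) (x∉p⇒x∈∁p a∉S)
  ... | p , q , p∈S , q∈S , p≢q , S⊆pq | I , sound , complete = at
    where
    J = ∁ (I ∪ S)

    I∩S=∅ : ∀ {x} → x ∈ I → x ∉ S
    I∩S=∅ = x∈∁p⇒x∉p ∘ walk-target ∘ sound
    ∈J⇒∉I : ∀ {x} → x ∈ J → x ∉ I
    ∈J⇒∉I x∈J x∈I = x∈∁p⇒x∉p x∈J (∈∪ˡ x∈I)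
    ∈J⇒∉S : ∀ {x} → x ∈ J → x ∉ S
    ∈J⇒∉S x∈J x∈S = x∈∁p⇒x∉p x∈J (∈∪ʳ x∈S)
    ∈S⇒≢ : ∀ {x y} → x ∉ S → y ∈ S → x ≢ y
    ∈S⇒≢ x∉S y∈S refl = x∉S y∈S
    a∈I : a ∈ I
    a∈I = complete (here (x∉p⇒x∈∁p a∉S))
    step-I : ∀ {u w} → u ∈ I → E u w → w ∉ S → w ∈ I
    step-I u∈I e w∉S = complete (walk-snoc (sound u∈I) e (x∉p⇒x∈∁p w∉S))
    J-or : ∀ w → w ∈ I ⊎ w ∈ S ⊎ w ∈ J
    J-or w with w ∈? I | w ∈? S
    ... | yes w∈I | _ = inj₁ w∈I
    ... | no _ | yes w∈S = inj₂ (inj₁ w∈S)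
    ... | no w∉I | no w∉S = inj₂ (inj₂ (x∉p⇒x∈∁p ([ w∉I , w∉S ]′ ∘ x∈p∪q⁻ I S)))

    closed-I : ∀ {u w} → u ∈ I → E u w → w ∈ I ⊎ w ≡ p ⊎ w ≡ q
    closed-I {w = w} u∈I e with w ∈? S
    ... | yes w∈S = inj₂ (S⊆pq w∈S)
    ... | no w∉S = inj₁ (step-I u∈I e w∉S)
    closed-J : ∀ {u w} → u ∈ J → E u w → w ∈ J ⊎ w ≡ p ⊎ w ≡ q
    closed-J {w = w} u∈J e with J-or w
    ... | inj₁ w∈I = contradiction (step-I w∈I (edge-sym G e) (∈J⇒∉S u∈J)) (∈J⇒∉I u∈J)
    ... | inj₂ (inj₁ w∈S) = inj₂ (S⊆pq w∈S)
    ... | inj₂ (inj₂ w∈J) = inj₁ w∈J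

    rec-I = piece-neighbours unsplit b∈A I (⊂-wellFounded I) p≢q
      (λ p∈I → I∩S=∅ p∈I p∈S) (λ q∈I → I∩S=∅ q∈I q∈S) (¬ab ∘ sound)
      (∈S⇒≢ b∉S p∈S) (∈S⇒≢ b∉S q∈S) closed-I
    rec-J = piece-neighbours unsplit a∈A J (⊂-wellFounded J) p≢q
      (λ p∈J → ∈J⇒∉S p∈J p∈S) (λ q∈J → ∈J⇒∉S q∈J q∈S) (λ a∈J → ∈J⇒∉I a∈J a∈I)
      (∈S⇒≢ a∉S p∈S) (∈S⇒≢ a∉S q∈S) closed-J

    at-end : ∀ {x y} → (∀ {w} → w ∈ S → w ≡ x ⊎ w ≡ y) →
             AtMostOneNeighbour G A x (λ w → w ∈ I ⊎ w ≡ y) → AtMostOneNeighbour G A x (λ w → w ∈ J ⊎ w ≡ y) →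
             AtMostTwoNeighbours G A x
    at-end {x} {y} S⊆xy (u , unique-u) (v , unique-v) = u , v , λ {w} w∈A e → side w∈A e (J-or w)
      where
      side : ∀ {w} → w ∈ A → E x w → w ∈ I ⊎ w ∈ S ⊎ w ∈ J → w ≡ u ⊎ w ≡ v
      side w∈A e (inj₁ w∈I) = inj₁ (unique-u w∈A e (inj₁ w∈I))
      side w∈A e (inj₂ (inj₂ w∈J)) = inj₂ (unique-v w∈A e (inj₁ w∈J))
      side {w} w∈A e (inj₂ (inj₁ w∈S)) with S⊆xy w∈S
      ... | inj₁ refl = contradiction e (Graph.noLoop G w)
      -- A possible edge between the two ends is charged to the `I` side, whose bound already
      -- includes the other end.
      ... | inj₂ w≡y = inj₁ (unique-u w∈A e (inj₂ w≡y))

    at : AtMostTwoNeighbours G A x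
    at with J-or x
    ... | inj₁ x∈I = proj₂ (proj₂ rec-I) x∈I
    ... | inj₂ (inj₂ x∈J) = proj₂ (proj₂ rec-J) x∈J
    ... | inj₂ (inj₁ x∈S) with S⊆pq x∈S
    ... | inj₁ refl = at-end S⊆pq (proj₁ rec-I) (proj₁ rec-J)
    ... | inj₂ refl = at-end (swap ∘ S⊆pq) (proj₁ (proj₂ rec-I)) (proj₁ (proj₂ rec-J))

-- Parts that are not blocks

module _ {n : ℕ} (G : Graph n) (biconnected : Biconnected G) where

  private
    E = Edge G

  module _ {A : Subset n} (part : IsPart G A) where

    separating-single : ∀ {v} → v ∉ A → ∃ λ S →
      Single G S × v ∉ S × A ⊈ S × (∀ {x} → x ∈ A → ¬ Walk E (∁ S) v x)
    separating-single {v} v∉A with proj₂ part v v∉A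
    ... | S , single , v⊈S , A⊈S , separates = S , single , v∉S , A⊈S ,
      λ x∈A vx → separates _ _ (x∈⁅x⁆ v) v∉S x∈A (x∈∁p⇒x∉p (walk-target vx)) vx
      where
      v∉S : v ∉ S
      v∉S v∈S = v⊈S λ x∈v → subst (_∈ S) (sym (x∈⁅y⁆⇒x≡y v x∈v)) v∈S

    -- The component of v is as large as possible when S ⊆ A: if s ∈ S lies
    -- outside A, a single cutset T separating s from A cuts off v together with
    -- its component in G − S and s.
    separating-single⊆ : ∀ {v} → v ∉ A → ∃ λ S →
      Single G S × v ∉ S × S ⊆ A × (∀ {x} → x ∈ A → ¬ Walk E (∁ S) v x)
    separating-single⊆ {v} v∉A with separating-single v∉A
    ... | S , single , v∉S , A⊈S , separates with component (edge? G) (x∉p⇒x∈∁p v∉S)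
    ... | K , sound , complete = enlarge S single v∉S A⊈S separates K (⊃-wellFounded K) sound complete
      where
      enlarge : ∀ S → Single G S → v ∉ S → A ⊈ S → (∀ {x} → x ∈ A → ¬ Walk E (∁ S) v x) →
        ∀ K → Acc _⊃_ K → (∀ {y} → y ∈ K → Walk E (∁ S) v y) → (∀ {y} → Walk E (∁ S) v y → y ∈ K) →
        ∃ λ S → Single G S × v ∉ S × S ⊆ A × (∀ {x} → x ∈ A → ¬ Walk E (∁ S) v x)
      enlarge S single v∉S A⊈S separates K (acc rs) sound complete
        with any? (λ s → s ∈? S ×-dec ¬? (s ∈? A))
      ... | no S⊆A = S , single , v∉S ,
        (λ {s} s∈S → decidable-stable (s ∈? A) λ s∉A → S⊆A (s , s∈S , s∉A)) , separates
      ... | yes (s , s∈S , s∉A) with separating-single s∉A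
      ... | T , single-T , s∉T , A⊈T , separates-T with any? (λ t → t ∈? T ×-dec t ∈? K)
      -- Since `S` does not split `T` and `T` meets `K`, the component in G - S of any `x` in `A`
      -- outside `S` avoids `T`. Then `s` attaches to `x` without meeting `T`, which is impossible;
      -- so `A` would lie in `S`.
      ... | yes (t , t∈T , t∈K) = ⊥-elim (A⊈S λ {x} x∈A → decidable-stable (x ∈? S) (¬x∉S x∈A))
        where
        T≢S : T ≢ S
        T≢S refl = s∉T s∈S
        ¬x∉S : ∀ {x} → x ∈ A → ¬ x ∉ S
        ¬x∉S {x} x∈A x∉S = separates-T x∈A
          (attach G biconnected (proj₂ (proj₁ single)) s∈S x∉S (x∉p⇒x∈∁p s∉T) avoid)
          where
          avoid : ∀ {y} → Walk E (∁ S) x y → y ∈ ∁ T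
          avoid {y} xy = x∉p⇒x∈∁p λ y∈T → proj₁ (proj₂ single T (proj₁ single-T) T≢S)
            (t , y , t∈T , x∈∁p⇒x∉p (walk-target (sound t∈K)) , y∈T , x∈∁p⇒x∉p (walk-target xy) ,
             λ ty → separates x∈A (walk-trans (sound t∈K) (walk-trans ty (conn-sym G xy))))
      ... | no T∩K=∅ with component (edge? G) (walk-target sv)
        where
        sv : Walk E (∁ T) s v
        sv = attach G biconnected (proj₂ (proj₁ single)) s∈S v∉S (x∉p⇒x∈∁p s∉T)
          λ vy → x∉p⇒x∈∁p λ y∈T → T∩K=∅ (_ , y∈T , complete vy)
      ... | K′ , sound′ , complete′ =
        enlarge T single-T (x∈∁p⇒x∉p (walk-target sv)) A⊈T
          (λ x∈A vx → separates-T x∈A (walk-trans sv vx)) K′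
          (rs ((λ y∈K → complete′ (walk-reachable (sound y∈K) avoid)) ,
               s , complete′ (conn-sym G sv) , λ s∈K → x∈∁p⇒x∉p (walk-target (sound s∈K)) s∈S))
          sound′ complete′
        where
        avoid : ∀ {y} → Walk E (∁ S) v y → y ∈ ∁ T
        avoid vy = x∉p⇒x∈∁p λ y∈T → T∩K=∅ (_ , y∈T , complete vy)
        sv : Walk E (∁ T) s v
        sv = attach G biconnected (proj₂ (proj₁ single)) s∈S v∉S (x∉p⇒x∈∁p s∉T) avoid

    -- An excursion of the walk outside A leaves and returns through one single
    -- cutset, which is an edge of G'.
    walk-in-part : ∀ {R u y} → Walk E (∁ R) u y → y ∈ A →
      (u ∈ A → Walk (Edge' G) (A ─ R) u y) ×
      (∀ {S} → Single G S → S ⊆ A → u ∉ S → (∀ {x} → x ∈ A → ¬ Walk E (∁ S) u x) →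
        ∃ λ s → s ∈ S × Walk (Edge' G) (A ─ R) s y)
    walk-in-part (here u∈∁R) y∈A =
      (λ u∈A → here (x∈p∧x∉q⇒x∈p─q u∈A (x∈∁p⇒x∉p u∈∁R))) ,
      λ single S⊆A u∉S separates → ⊥-elim (separates y∈A (here (x∉p⇒x∈∁p u∉S)))
    walk-in-part {R} {u} {y} (step {w = w} u∈∁R uw wy) y∈A with walk-in-part wy y∈A
    ... | from-A , from-outside = from-A′ , from-outside′
      where
      E-step : ∀ {S} → u ∉ S → w ∉ S → Walk E (∁ S) u w
      E-step u∉S w∉S = step (x∉p⇒x∈∁p u∉S) uw (here (x∉p⇒x∈∁p w∉S))
      from-A′ : u ∈ A → Walk (Edge' G) (A ─ R) u y
      from-A′ u∈A with w ∈? A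
      ... | yes w∈A = step (x∈p∧x∉q⇒x∈p─q u∈A (x∈∁p⇒x∉p u∈∁R)) (inj₁ uw) (from-A w∈A)
      ... | no w∉A with separating-single⊆ w∉A
      ... | S , single , w∉S , S⊆A , separates with from-outside single S⊆A w∉S separates
      ... | s , s∈S , sy with u ≟ s
      ... | yes refl = sy
      ... | no u≢s = step (x∈p∧x∉q⇒x∈p─q u∈A (x∈∁p⇒x∉p u∈∁R))
        (inj₂ (subst (Single G) (∣p∣≡2⇒≡pair (proj₂ (proj₁ single)) u∈S s∈S u≢s) single)) sy
        where
        u∈S : u ∈ S
        -- Otherwise the edge from `u` would join `w` to `A` in G - S.
        u∈S = decidable-stable (u ∈? S) λ u∉S → separates u∈A (conn-sym G (E-step u∉S w∉S))
      from-outside′ : ∀ {S} → Single G S → S ⊆ A → u ∉ S → (∀ {x} → x ∈ A → ¬ Walk E (∁ S) u x) →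
        ∃ λ s → s ∈ S × Walk (Edge' G) (A ─ R) s y
      from-outside′ {S} single S⊆A u∉S separates with w ∈? S
      ... | yes w∈S = w , w∈S , from-A (S⊆A w∈S)
      ... | no w∉S = from-outside single S⊆A w∉S λ x∈A wx → separates x∈A (walk-trans (E-step u∉S w∉S) wx)

    -- With at most three vertices in `A` the degree bound is immediate. Otherwise a non-block has a
    -- cutset `R` of G'(A) with fewer than three vertices; by `walk-in-part` it separates the same
    -- two vertices in G, so biconnectivity forces exactly two vertices.
    block⊎atMostTwoNeighbours : IsBlock G A ⊎ (∀ {x} → x ∈ A → AtMostTwoNeighbours G A x)
    block⊎atMostTwoNeighbours with 3 ℕ.<? ∣ A ∣
    ... | no ∣A∣≯3 = inj₂ small
      where
      small : ∀ {x} → x ∈ A → AtMostTwoNeighbours G A x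
      small {x} x∈A with ∣p∣≤2⇒⊆pair {p = A - x} x (ℕ.≤-pred (ℕ.≤-trans (x∈p⇒∣p-x∣<∣p∣ x∈A) (ℕ.≮⇒≥ ∣A∣≯3)))
      ... | y , z , A-x⊆yz = y , z , λ {w} w∈A xw → A-x⊆yz (x∈p∧x≢y⇒x∈p-y w∈A λ { refl → Graph.noLoop G w xw })
    ... | yes 3<∣A∣ with anySubset? (λ R → cutsetIn? (edge'? G) A R ×-dec ∣ R ∣ ℕ.<? 3)
    ... | no ¬∃ = inj₁ (part , 3<∣A∣ , λ R cutset → ℕ.≮⇒≥ λ ∣R∣<3 → ¬∃ (R , cutset , ∣R∣<3))
    ... | yes (R , (R⊆A , x , y , x∈ , y∈ , ¬xy′) , ∣R∣<3) =
      inj₂ λ _ → split-neighbours G biconnected (proj₁ part)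
        (¬conn⇒Cutset G x∉R y∉R ¬xy , ℕ.≤-antisym (ℕ.≤-pred ∣R∣<3) (¬conn⇒2≤∣S∣ G biconnected x∉R y∉R ¬xy))
        (x , y , x∈A , x∉R , y∈A , y∉R , ¬xy) _
      where
      x∈A : x ∈ A
      x∈A = p─q⊆p A R x∈
      y∈A : y ∈ A
      y∈A = p─q⊆p A R y∈
      x∉R : x ∉ R
      x∉R = ∈─⇒∉ A R x∈
      y∉R : y ∉ R
      y∉R = ∈─⇒∉ A R y∈
      ¬xy : ¬ Walk E (∁ R) x y
      ¬xy xy = ¬xy′ (proj₁ (walk-in-part xy y∈A) x∈A)

-- Extending list colourings

remove : ℕ → List ℕ → List ℕ
remove x = filter λ y → ¬? (y ℕ.≟ x)

length-remove : ∀ x {xs} → Unique xs → length xs ≤ suc (length (remove x xs))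
length-remove x {[]} _ = z≤n
length-remove x {y ∷ ys} (y≢ys AllPairs.∷ unique) with y ℕ.≟ x
... | yes refl = s≤s (ℕ.≤-reflexive (sym (cong length
        (trans (filter-reject (λ z → ¬? (z ℕ.≟ x)) (λ y≢x → y≢x refl))
               (filter-all (λ z → ¬? (z ℕ.≟ x)) (All.map (λ x≢z z≡x → x≢z (sym z≡x)) y≢ys))))))
... | no y≢x = s≤s (ℕ.≤-trans (length-remove x unique)
        (ℕ.≤-reflexive (sym (cong length (filter-accept (λ z → ¬? (z ℕ.≟ x)) y≢x)))))

-- A list without repetitions loses at most one entry per deletion, so at least `m` remain. `take`
-- then cuts to length exactly `a`, as `ChoosableOn` demands.
restrict-list : ∀ {a m} → a ≤ m → ∀ x y {xs} → length xs ≡ m + 2 → Unique xs →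
  ∃ λ ys → (length ys ≡ a × Unique ys) × (∀ {z} → z ∈ˡ ys → z ∈ˡ xs × z ≢ x × z ≢ y)
restrict-list {a} {m} a≤m x y {xs} ∣xs∣ unique =
  take a zs , (trans (length-take a zs) (ℕ.m≤n⇒m⊓n≡m a≤∣zs∣) , Unique.take⁺ a unique-zs) ,
  λ z∈ → let z∈₁ , z≢y = ∈-filter⁻ (λ z → ¬? (z ℕ.≟ y)) (All.lookup (All.take⁺ a (All.tabulate id)) z∈)
             z∈₂ , z≢x = ∈-filter⁻ (λ z → ¬? (z ℕ.≟ x)) z∈₁
         in z∈₂ , z≢x , z≢y
  where
  zs = remove y (remove x xs)
  unique-zs : Unique zs
  unique-zs = Unique.filter⁺ _ (Unique.filter⁺ _ unique)
  a≤∣zs∣ : a ≤ length zs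
  a≤∣zs∣ = ℕ.≤-trans a≤m (ℕ.≤-pred (ℕ.≤-pred (ℕ.≤-trans
    (ℕ.≤-reflexive (trans (ℕ.+-comm 2 m) (sym ∣xs∣)))
    (ℕ.≤-trans (length-remove x unique) (s≤s (length-remove y (Unique.filter⁺ _ unique)))))))

merge : ∀ {n} {A : Set} → Subset n → (f g : Fin n → A) → Fin n → A
merge P f g v = if does (v ∈? P) then f v else g v

merge-∈ : ∀ {n} {A : Set} {P : Subset n} (f g : Fin n → A) {v} → v ∈ P → merge P f g v ≡ f v
merge-∈ {P = P} f g {v} v∈P = cong (if_then f v else g v) (dec-true (v ∈? P) v∈P)

module _ {n : ℕ} (G : Graph n) where

  private
    E = Edge G

  Colours : (Fin n → List ℕ) → Subset n → (Fin n → ℕ) → Set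
  Colours L U c = (∀ v → v ∈ U → c v ∈ˡ L v) × (∀ u v → u ∈ U → v ∈ U → E u v → c u ≢ c v)

  Extendable : (Fin n → List ℕ) → Subset n → Subset n → Set
  Extendable L P U = ∀ c → Colours L P c → ∃ λ c′ → Colours L U c′ × (∀ {v} → v ∈ P → c′ v ≡ c v)

  colours-⊆ : ∀ {L P U c} → P ⊆ U → Colours L U c → Colours L P c
  colours-⊆ P⊆U (listed , proper) =
    (λ v v∈P → listed v (P⊆U v∈P)) , λ u v u∈P v∈P → proper u v (P⊆U u∈P) (P⊆U v∈P)

  -- `U₁` is coloured first and its colours on `Z` are extended over `U₂`. The two colourings agree
  -- on the overlap, and every edge between the sets lies inside one of them.
  extend-glue : ∀ {L P Z U U₁ U₂} → (∀ {v} → v ∈ U → v ∈ U₁ ⊎ v ∈ U₂) →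
    (∀ {v} → v ∈ U₁ → v ∈ U₂ → v ∈ Z) → Z ⊆ U₁ → P ⊆ U₁ →
    (∀ {u v} → u ∈ U₁ → v ∈ U₂ → E u v → u ∈ U₂ ⊎ v ∈ U₁) →
    Extendable L P U₁ → Extendable L Z U₂ → Extendable L P U
  extend-glue {L} {P} {Z} {U} {U₁} {U₂} cover common Z⊆U₁ P⊆U₁ crossing extend₁ extend₂ c colours
    with extend₁ c colours
  ... | c₁ , colours₁ , agrees₁ with extend₂ c₁ (colours-⊆ {L} Z⊆U₁ colours₁)
  ... | c₂ , colours₂ , agrees₂ = c′ , (listed , proper) , λ v∈P → trans (c′≡c₁ (P⊆U₁ v∈P)) (agrees₁ v∈P)
    where
    c′ = merge U₁ c₁ c₂
    c′≡c₁ : ∀ {v} → v ∈ U₁ → c′ v ≡ c₁ v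
    c′≡c₁ = merge-∈ c₁ c₂
    c′≡c₂ : ∀ {v} → v ∈ U₂ → c′ v ≡ c₂ v
    c′≡c₂ {v} v∈U₂ with v ∈? U₁
    ... | yes v∈U₁ = sym (agrees₂ (common v∈U₁ v∈U₂))
    ... | no _ = refl
    listed : ∀ v → v ∈ U → c′ v ∈ˡ L v
    listed v v∈U with cover v∈U
    ... | inj₁ v∈U₁ = subst (_∈ˡ L v) (sym (c′≡c₁ v∈U₁)) (proj₁ colours₁ v v∈U₁)
    ... | inj₂ v∈U₂ = subst (_∈ˡ L v) (sym (c′≡c₂ v∈U₂)) (proj₁ colours₂ v v∈U₂)
    proper₁ : ∀ {u v} → u ∈ U₁ → v ∈ U₁ → E u v → c′ u ≢ c′ v
    proper₁ u∈ v∈ e = subst₂ _≢_ (sym (c′≡c₁ u∈)) (sym (c′≡c₁ v∈)) (proj₂ colours₁ _ _ u∈ v∈ e)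
    proper₂ : ∀ {u v} → u ∈ U₂ → v ∈ U₂ → E u v → c′ u ≢ c′ v
    proper₂ u∈ v∈ e = subst₂ _≢_ (sym (c′≡c₂ u∈)) (sym (c′≡c₂ v∈)) (proj₂ colours₂ _ _ u∈ v∈ e)
    proper₁₂ : ∀ {u v} → u ∈ U₁ → v ∈ U₂ → E u v → c′ u ≢ c′ v
    proper₁₂ u∈ v∈ e = [ (λ u∈₂ → proper₂ u∈₂ v∈ e) , (λ v∈₁ → proper₁ u∈ v∈₁ e) ]′ (crossing u∈ v∈ e)
    proper : ∀ u v → u ∈ U → v ∈ U → E u v → c′ u ≢ c′ v
    proper u v u∈ v∈ e with cover u∈ | cover v∈
    ... | inj₁ u∈₁ | inj₁ v∈₁ = proper₁ u∈₁ v∈₁ e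
    ... | inj₂ u∈₂ | inj₂ v∈₂ = proper₂ u∈₂ v∈₂ e
    ... | inj₁ u∈₁ | inj₂ v∈₂ = proper₁₂ u∈₁ v∈₂ e
    ... | inj₂ u∈₂ | inj₁ v∈₁ = proper₁₂ v∈₁ u∈₂ (edge-sym G e) ∘ sym

  -- The two grounds for extending from lists of size m + 2: spare room for two deleted colours, or
  -- degree at most two with lists of size at least three.
  Manageable : ℕ → Subset n → Set
  Manageable m A = (∃ λ a → a ≤ m × ChoosableOn G A a) ⊎
                 (1 ≤ m × (∀ {x} → x ∈ A → AtMostTwoNeighbours G A x))

  module _ {L : Fin n → List ℕ} {m : ℕ} (sized : ∀ v → length (L v) ≡ m + 2 × Unique (L v)) where

    extend-choosable : ∀ {A U P a} {p q : Fin n} → ChoosableOn G A a → a ≤ m → U ⊆ A → P ⊆ U →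
      (∀ {v} → v ∈ P → v ≡ p ⊎ v ≡ q) → Extendable L P U
    extend-choosable {A} {U} {P} {a} {p} {q} choosable a≤m U⊆A P⊆U P⊆pq c (listed , proper) =
      c″ , (listed″ , proper″) , merge-∈ c c′
      where
      restricted : ∀ v → ∃ λ ys → (length ys ≡ a × Unique ys) ×
        (∀ {z} → z ∈ˡ ys → z ∈ˡ L v × z ≢ c p × z ≢ c q)
      -- If `p` or `q` lies outside `P`, the value of `c` there is arbitrary and deleting it does no
      -- harm.
      restricted v = restrict-list a≤m (c p) (c q) (proj₁ (sized v)) (proj₂ (sized v))
      chosen : ∃ (Colours (proj₁ ∘ restricted) A)
      chosen = choosable (proj₁ ∘ restricted) λ v _ → proj₁ (proj₂ (restricted v))
      c′ = proj₁ chosen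
      c″ = merge P c c′
      c′-avoids : ∀ {u v} → u ∈ P → v ∈ U → c′ v ≢ c u
      c′-avoids {v = v} u∈P v∈U
        with P⊆pq u∈P | proj₂ (proj₂ (restricted v)) (proj₁ (proj₂ chosen) v (U⊆A v∈U))
      ... | inj₁ refl | _ , ≢cp , _ = ≢cp
      ... | inj₂ refl | _ , _ , ≢cq = ≢cq
      listed″ : ∀ v → v ∈ U → c″ v ∈ˡ L v
      listed″ v v∈U with v ∈? P
      ... | yes v∈P = listed v v∈P
      ... | no _ = proj₁ (proj₂ (proj₂ (restricted v)) (proj₁ (proj₂ chosen) v (U⊆A v∈U)))
      proper″ : ∀ u v → u ∈ U → v ∈ U → E u v → c″ u ≢ c″ v
      proper″ u v u∈U v∈U e with u ∈? P | v ∈? P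
      ... | yes u∈P | yes v∈P = proper u v u∈P v∈P e
      ... | yes u∈P | no _ = c′-avoids u∈P v∈U ∘ sym
      ... | no _ | yes v∈P = c′-avoids v∈P u∈U
      ... | no _ | no _ = proj₂ (proj₂ chosen) u v (U⊆A u∈U) (U⊆A v∈U) e

    extend-greedily : ∀ {A U} → 1 ≤ m → (∀ {x} → x ∈ A → AtMostTwoNeighbours G A x) → U ⊆ A →
      ∀ P → Acc _⊃_ P → P ⊆ U → Extendable L P U
    extend-greedily {A} {U} 1≤m two U⊆A P (acc rs) P⊆U c colours@(listed , proper)
      with any? (λ v → v ∈? U ×-dec ¬? (v ∈? P))
    ... | no U⊆P = c ,
      colours-⊆ {L} (λ {v} v∈U → decidable-stable (v ∈? P) λ v∉P → U⊆P (v , v∈U , v∉P)) colours , λ _ → refl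
    ... | yes (v , v∈U , v∉P) with two (U⊆A v∈U)
    -- Length 1 is requested: the single entry is a colour for `v` that differs from those of both
    -- possible neighbours.
    ... | y , z , nbrs with restrict-list 1≤m (c y) (c z) (proj₁ (sized v)) (proj₂ (sized v))
    ... | k ∷ [] , _ , k∈
      with extend-greedily 1≤m two U⊆A (P ∪ ⁅ v ⁆) (rs (p⊂p∪⁅x⁆ v∉P)) P∪v⊆U c₁ (listed₁ , proper₁)
      where
      c₁ = merge P c (λ _ → k)
      P∪v⊆U : P ∪ ⁅ v ⁆ ⊆ U
      P∪v⊆U = [ P⊆U , (λ { x∈v → subst (_∈ U) (sym (x∈⁅y⁆⇒x≡y v x∈v)) v∈U }) ]′ ∘ x∈p∪q⁻ P ⁅ v ⁆
      ∉P⇒≡v : ∀ {u} → u ∈ P ∪ ⁅ v ⁆ → u ∉ P → u ≡ v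
      ∉P⇒≡v u∈ u∉P = [ (λ u∈P → contradiction u∈P u∉P) , x∈⁅y⁆⇒x≡y v ]′ (x∈p∪q⁻ P ⁅ v ⁆ u∈)
      k-avoids : ∀ {u} → u ∈ P → E v u → k ≢ c u
      k-avoids u∈P e with nbrs (U⊆A (P⊆U u∈P)) e | k∈ (here refl)
      ... | inj₁ refl | _ , k≢cy , _ = k≢cy
      ... | inj₂ refl | _ , _ , k≢cz = k≢cz
      listed₁ : ∀ u → u ∈ P ∪ ⁅ v ⁆ → c₁ u ∈ˡ L u
      listed₁ u u∈ with u ∈? P
      ... | yes u∈P = listed u u∈P
      ... | no u∉P with refl ← ∉P⇒≡v u∈ u∉P = proj₁ (k∈ (here refl))
      proper₁ : ∀ u w → u ∈ P ∪ ⁅ v ⁆ → w ∈ P ∪ ⁅ v ⁆ → E u w → c₁ u ≢ c₁ w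
      proper₁ u w u∈ w∈ e with u ∈? P | w ∈? P
      ... | yes u∈P | yes w∈P = proper u w u∈P w∈P e
      ... | yes u∈P | no w∉P with refl ← ∉P⇒≡v w∈ w∉P = k-avoids u∈P (edge-sym G e) ∘ sym
      ... | no u∉P | yes w∈P with refl ← ∉P⇒≡v u∈ u∉P = k-avoids w∈P e
      ... | no u∉P | no w∉P with refl ← ∉P⇒≡v u∈ u∉P | refl ← ∉P⇒≡v w∈ w∉P = contradiction e (Graph.noLoop G v)
    ... | c₂ , colours₂ , agrees₂ = c₂ , colours₂ ,
      λ u∈P → trans (agrees₂ (∈∪ˡ u∈P)) (merge-∈ c (λ _ → k) u∈P)

    extend-unsplit : (∀ {A} → IsPart G A → Manageable m A) →
      ∀ U → Acc _⊂_ U → ∀ {P} {p q : Fin n} → P ⊆ U → (∀ {v} → v ∈ P → v ≡ p ⊎ v ≡ q) →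
      Unsplit G P → Extendable L P U
    extend-unsplit manageable U (acc rs) {P} P⊆U P⊆pq unsplit
      with anySubset? (λ T → single? G T ×-dec splits? G T U)
    ... | no ¬split with unsplit⊆part G {U} (λ S single split → ¬split (S , single , split))
    ... | A , part , U⊆A with manageable part
    ... | inj₁ (a , a≤m , choosable) = extend-choosable choosable a≤m U⊆A P⊆U P⊆pq
    ... | inj₂ (1≤m , two) = extend-greedily 1≤m two U⊆A P (⊃-wellFounded P) P⊆U
    extend-unsplit manageable U (acc rs) {P} P⊆U P⊆pq unsplit
      | yes (T , single , x , y , x∈U , x∉T , y∈U , y∉T , ¬xy)
      with component (edge? G) (x∉p⇒x∈∁p x∉T) | ∣p∣≡2⇒elements (proj₂ (proj₁ single))
    -- `T` does not split `P`: if `P` meets `C` it lies in C ∪ T, and otherwise it misses `C`. The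
    -- side containing `P` is coloured first.
    ... | C , sound , complete | s , t , _ , _ , _ , T⊆st = by-side (any? λ v → v ∈? P ×-dec v ∈? C)
      where
      U₁ = U ∩ (C ∪ T)
      U₂ = U ─ C
      Z = U ∩ T
      ∈U₁⁻ : ∀ {v} → v ∈ U₁ → v ∈ U × (v ∈ C ⊎ v ∈ T)
      ∈U₁⁻ v∈ = let v∈U , v∈C∪T = x∈p∩q⁻ U (C ∪ T) v∈ in v∈U , x∈p∪q⁻ C T v∈C∪T
      C∩T=∅ : ∀ {v} → v ∈ C → v ∉ T
      C∩T=∅ = x∈∁p⇒x∉p ∘ walk-target ∘ sound
      U₁⊂U : U₁ ⊂ U
      U₁⊂U = p∩q⊆p U (C ∪ T) , y , y∈U , [ ¬xy ∘ sound , y∉T ]′ ∘ proj₂ ∘ ∈U₁⁻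
      U₂⊂U : U₂ ⊂ U
      U₂⊂U = p─q⊆p U C , x , x∈U , λ x∈U₂ → ∈─⇒∉ U C x∈U₂ (complete (here (x∉p⇒x∈∁p x∉T)))
      Z⊆U₁ : Z ⊆ U₁
      Z⊆U₁ v∈Z = let v∈U , v∈T = x∈p∩q⁻ U T v∈Z in x∈p∩q⁺ (v∈U , ∈∪ʳ v∈T)
      Z⊆U₂ : Z ⊆ U₂
      Z⊆U₂ v∈Z = let v∈U , v∈T = x∈p∩q⁻ U T v∈Z in x∈p∧x∉q⇒x∈p─q v∈U λ v∈C → C∩T=∅ v∈C v∈T
      common : ∀ {v} → v ∈ U₁ → v ∈ U₂ → v ∈ Z
      common v∈U₁ v∈U₂ with ∈U₁⁻ v∈U₁
      ... | v∈U , inj₁ v∈C = contradiction v∈C (∈─⇒∉ U C v∈U₂)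
      ... | v∈U , inj₂ v∈T = x∈p∩q⁺ (v∈U , v∈T)
      cover : ∀ {v} → v ∈ U → v ∈ U₁ ⊎ v ∈ U₂
      cover {v} v∈U with v ∈? C
      ... | yes v∈C = inj₁ (x∈p∩q⁺ (v∈U , ∈∪ˡ v∈C))
      ... | no v∉C = inj₂ (x∈p∧x∉q⇒x∈p─q v∈U v∉C)
      crossing : ∀ {u v} → u ∈ U₁ → v ∈ U₂ → E u v → u ∈ U₂ ⊎ v ∈ U₁
      crossing {u} {v} u∈U₁ v∈U₂ e with ∈U₁⁻ u∈U₁ | v ∈? T
      ... | u∈U , inj₂ u∈T | _ = inj₁ (Z⊆U₂ (x∈p∩q⁺ (u∈U , u∈T)))
      ... | u∈U , inj₁ u∈C | yes v∈T = inj₂ (Z⊆U₁ (x∈p∩q⁺ (p─q⊆p U C v∈U₂ , v∈T)))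
      ... | u∈U , inj₁ u∈C | no v∉T =
        contradiction (complete (walk-snoc (sound u∈C) e (x∉p⇒x∈∁p v∉T))) (∈─⇒∉ U C v∈U₂)
      unsplit-Z : Unsplit G Z
      unsplit-Z S single-S split = single-unsplit G single S single-S (splits-mono G (p∩q⊆q U T) split)
      Z⊆st : ∀ {v} → v ∈ Z → v ≡ s ⊎ v ≡ t
      Z⊆st = T⊆st ∘ p∩q⊆q U T
      by-side : Dec (∃ λ v → v ∈ P × v ∈ C) → Extendable L P U
      by-side (yes (v , v∈P , v∈C)) =
        extend-glue cover common Z⊆U₁ P⊆U₁ crossing
          (extend-unsplit manageable U₁ (rs U₁⊂U) P⊆U₁ P⊆pq unsplit)
          (extend-unsplit manageable U₂ (rs U₂⊂U) Z⊆U₂ Z⊆st unsplit-Z)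
        where
        P⊆U₁ : P ⊆ U₁
        P⊆U₁ {w} w∈P with w ∈? T
        ... | yes w∈T = x∈p∩q⁺ (P⊆U w∈P , ∈∪ʳ w∈T)
        ... | no w∉T = x∈p∩q⁺ (P⊆U w∈P , ∈∪ˡ (complete (walk-trans (sound v∈C)
                         (unsplit-conn G unsplit single v∈P (C∩T=∅ v∈C) w∈P w∉T))))
      by-side (no P∩C=∅) =
        extend-glue (swap ∘ cover) (λ v∈U₂ v∈U₁ → common v∈U₁ v∈U₂) Z⊆U₂ P⊆U₂
          (λ u∈U₂ v∈U₁ e → swap (crossing v∈U₁ u∈U₂ (edge-sym G e)))
          (extend-unsplit manageable U₂ (rs U₂⊂U) P⊆U₂ P⊆pq unsplit)
          (extend-unsplit manageable U₁ (rs U₁⊂U) Z⊆U₁ Z⊆st unsplit-Z)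
        where
        P⊆U₂ : P ⊆ U₂
        P⊆U₂ w∈P = x∈p∧x∉q⇒x∈p─q (P⊆U w∈P) λ w∈C → P∩C=∅ (_ , w∈P , w∈C)

-- Decidability of choosability

Exhaustible : Set → Set₁
Exhaustible A = ∀ {P : A → Set} → Decidable P → Dec (∃ P)

exhaustible-Vec : ∀ {A} → Exhaustible A → ∀ n → Exhaustible (Vec A n)
exhaustible-Vec any-A? zero P? = map′ (λ p → [] , p) (λ { ([] , p) → p }) (P? [])
exhaustible-Vec any-A? (suc n) P? = map′
  (λ (x , xs , p) → x ∷ xs , p)
  (λ { (x ∷ xs , p) → x , xs , p })
  (any-A? λ x → exhaustible-Vec any-A? n λ xs → P? (x ∷ xs))

exhaustible⇒all? : ∀ {A} → Exhaustible A → ∀ {P : A → Set} → Decidable P → Dec (∀ x → P x)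
exhaustible⇒all? any-A? P? = map′
  (λ ¬∃ x → decidable-stable (P? x) λ ¬p → ¬∃ (x , ¬p))
  (λ ∀p (x , ¬p) → ¬p (∀p x))
  (¬? (any-A? (¬? ∘ P?)))

least : ∀ {P : ℕ → Set} → Decidable P → ∀ k → P k → ∃ λ j → P j × (∀ i → P i → j ≤ i)
least P? k pk with P? 0
... | yes p0 = 0 , p0 , λ _ _ → z≤n
least P? zero p0 | no ¬p0 = contradiction p0 ¬p0
least P? (suc k) pk | no ¬p0 with least (P? ∘ suc) k pk
... | j , pj , minimal = suc j , pj , λ { zero p0 → contradiction p0 ¬p0 ; (suc i) pi → s≤s (minimal i pi) }

-- `f` gives the position of the first occurrence. Numbers that do not occur go to the extra last
-- index, hence `suc k`.
renumber : ∀ {k} (xs : Vec ℕ k) →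
  ∃₂ λ (f : ℕ → Fin (suc k)) (g : Fin (suc k) → ℕ) → ∀ {x} → x ∈ᵛ xs → g (f x) ≡ x
renumber [] = (λ _ → zero) , (λ _ → 0) , λ ()
renumber {suc k} (y ∷ ys) with renumber ys
... | f , g , g∘f = f′ , g′ , g′∘f′
  where
  f′ : ℕ → Fin (suc (suc k))
  f′ x with x ℕ.≟ y
  ... | yes _ = zero
  ... | no _ = suc (f x)
  g′ : Fin (suc (suc k)) → ℕ
  g′ zero = y
  g′ (suc i) = g i
  g′∘f′ : ∀ {x} → x ∈ᵛ y ∷ ys → g′ (f′ x) ≡ x
  g′∘f′ {x} x∈ with x ℕ.≟ y
  ... | yes x≡y = sym x≡y
  g′∘f′ (VecAny.here x≡y) | no x≢y = contradiction x≡y x≢y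
  g′∘f′ (VecAny.there x∈ys) | no _ = g∘f x∈ys

vec-of-length : ∀ {k} (xs : List ℕ) → length xs ≡ k → ∃ λ (ys : Vec ℕ k) → toList ys ≡ xs
vec-of-length xs refl = Vec.fromList xs , toList∘fromList xs

module _ {n : ℕ} (G : Graph n) where

  private
    E = Edge G

  -- Choosability with colours from `Fin m` and lists as vectors, so that both quantifiers range
  -- over finite sets.
  PaletteChoosable : Subset n → ℕ → ℕ → Set
  PaletteChoosable A k m = (M : Vec (Vec (Fin m) k) n) →
    (∀ v → v ∈ A → Unique (toList (lookup M v))) →
    ∃ λ (c : Vec (Fin m) n) →
      (∀ v → v ∈ A → lookup c v ∈ˡ toList (lookup M v)) ×
      (∀ u v → u ∈ A → v ∈ A → E u v → lookup c u ≢ lookup c v)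

  paletteChoosable? : ∀ A k m → Dec (PaletteChoosable A k m)
  paletteChoosable? A k m = exhaustible⇒all? (exhaustible-Vec (exhaustible-Vec any? k) n) λ M →
    (all? λ v → v ∈? A →-dec unique? (toList (lookup M v))) →-dec
    exhaustible-Vec any? n λ c →
      (all? λ v → v ∈? A →-dec (lookup c v ∈ˡ? toList (lookup M v))) ×-dec
      (all? λ u → all? λ v → u ∈? A →-dec v ∈? A →-dec edge? G u v →-dec ¬? (lookup c u ≟ lookup c v))
    where
    open DecUnique _≟_ using (unique?)
    open DecMembership _≟_ using () renaming (_∈?_ to _∈ˡ?_)

  choosable⇒palette : ∀ {A k m} → ChoosableOn G A k → PaletteChoosable A k (suc m)
  choosable⇒palette {A} {k} {m} choosable M unique = tabulate c′ , listed′ , proper′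
    where
    L : Fin n → List ℕ
    L v = List.map toℕ (toList (lookup M v))
    chosen : ∃ (Colours G L A)
    chosen = choosable L λ v v∈A →
      trans (length-map toℕ (toList (lookup M v))) (length-toList (lookup M v)) ,
      Unique.map⁺ toℕ-injective (unique v v∈A)
    c = proj₁ chosen
    preimage : ∀ v → ∃ λ x → v ∈ A → x ∈ˡ toList (lookup M v) × c v ≡ toℕ x
    preimage v with v ∈? A
    -- Vertices outside `A` need some colour, which is why the palette has the form `suc m`.
    ... | no v∉A = zero , λ v∈A → contradiction v∈A v∉A
    ... | yes v∈A = let x , x∈ , cv≡x = ∈-map⁻ toℕ (proj₁ (proj₂ chosen) v v∈A) in x , λ _ → x∈ , cv≡x
    c′ : Fin n → Fin (suc m)
    c′ = proj₁ ∘ preimage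
    listed′ : ∀ v → v ∈ A → lookup (tabulate c′) v ∈ˡ toList (lookup M v)
    listed′ v v∈A rewrite lookup∘tabulate c′ v = proj₁ (proj₂ (preimage v) v∈A)
    proper′ : ∀ u v → u ∈ A → v ∈ A → E u v → lookup (tabulate c′) u ≢ lookup (tabulate c′) v
    proper′ u v u∈A v∈A e rewrite lookup∘tabulate c′ u | lookup∘tabulate c′ v = λ c′u≡c′v →
      proj₂ (proj₂ chosen) u v u∈A v∈A e
        (trans (proj₂ (proj₂ (preimage u) u∈A)) (trans (cong toℕ c′u≡c′v) (sym (proj₂ (proj₂ (preimage v) v∈A)))))

  -- At most n * k colours occur in the lists.
  palette⇒choosable : ∀ {A k} → PaletteChoosable A k (suc (n * k)) → ChoosableOn G A k
  palette⇒choosable {A} {k} palette L sized = g ∘ lookup c , listed , proper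
    where
    vec : ∀ v → ∃ λ (xs : Vec ℕ k) → v ∈ A → toList xs ≡ L v
    vec v with v ∈? A
    -- Outside `A` the list may have any length, so a dummy vector stands in for it.
    ... | no v∉A = Vec.replicate k 0 , λ v∈A → contradiction v∈A v∉A
    ... | yes v∈A = let xs , eq = vec-of-length (L v) (proj₁ (sized v v∈A)) in xs , λ _ → eq
    V : Fin n → Vec ℕ k
    V = proj₁ ∘ vec
    renumbering = renumber (Vec.concat (tabulate V))
    f = proj₁ renumbering
    g = proj₁ (proj₂ renumbering)
    g∘f : ∀ {v x} → v ∈ A → x ∈ˡ L v → g (f x) ≡ x
    g∘f {v} {x} v∈A x∈ = proj₂ (proj₂ renumbering) (VecAny.concat⁺ (VecAny.tabulate⁺ v
      (VecAny.toList⁻ (subst (x ∈ˡ_) (sym (proj₂ (vec v) v∈A)) x∈))))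
    M : Vec (Vec (Fin (suc (n * k))) k) n
    M = tabulate (Vec.map f ∘ V)
    M≡ : ∀ {v} → v ∈ A → toList (lookup M v) ≡ List.map f (L v)
    M≡ {v} v∈A = trans (cong toList (lookup∘tabulate (Vec.map f ∘ V) v))
      (trans (toList-map f (V v)) (cong (List.map f) (proj₂ (vec v) v∈A)))
    unique-M : ∀ v → v ∈ A → Unique (toList (lookup M v))
    -- Mapping `g` over the renumbered list restores `L v`, so `f` created no repetition.
    unique-M v v∈A = subst Unique (sym (M≡ v∈A)) (Unique.map⁻ {f = g}
      (subst Unique (sym (trans (sym (map-∘ (L v))) (map-id-local (All.tabulate (g∘f v∈A)))))
        (proj₂ (sized v v∈A))))
    chosen = palette M unique-M
    c = proj₁ chosen
    original : ∀ {v} → v ∈ A → ∃ λ x → x ∈ˡ L v × lookup c v ≡ f x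
    original {v} v∈A = ∈-map⁻ f (subst (lookup c v ∈ˡ_) (M≡ v∈A) (proj₁ (proj₂ chosen) v v∈A))
    listed : ∀ v → v ∈ A → g (lookup c v) ∈ˡ L v
    listed v v∈A with original v∈A
    ... | x , x∈ , eq = subst (_∈ˡ L v) (sym (trans (cong g eq) (g∘f v∈A x∈))) x∈
    -- `g` may identify palette indices when `V` repeats a colour, but on indices coming from `f` it
    -- is undone by `f`, so properness survives.
    f∘g : ∀ {v} → v ∈ A → f (g (lookup c v)) ≡ lookup c v
    f∘g v∈A with original v∈A
    ... | x , x∈ , eq = trans (cong (f ∘ g) eq) (trans (cong f (g∘f v∈A x∈)) (sym eq))
    proper : ∀ u v → u ∈ A → v ∈ A → E u v → g (lookup c u) ≢ g (lookup c v)
    proper u v u∈A v∈A e gcu≡gcv = proj₂ (proj₂ chosen) u v u∈A v∈A e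
      (trans (sym (f∘g u∈A)) (trans (cong f gcu≡gcv) (f∘g v∈A)))

  choosable? : ∀ A k → Dec (ChoosableOn G A k)
  choosable? A k = map′ palette⇒choosable choosable⇒palette (paletteChoosable? A k (suc (n * k)))

  -- Choosability of subgraphs and existence of choice numbers

  choosable-⊆ : ∀ {A B k} → A ⊆ B → ChoosableOn G B k → ChoosableOn G A k
  choosable-⊆ {A} {B} {k} A⊆B choosable L sized with choosable L′ sized′
    where
    -- Vertices of `B` outside `A` get the dummy list 0, ..., k - 1 of the required length.
    L′ = merge A L (λ _ → upTo k)
    sized′ : ∀ v → v ∈ B → length (L′ v) ≡ k × Unique (L′ v)
    sized′ v _ with v ∈? A
    ... | yes v∈A = sized v v∈A
    ... | no _ = length-upTo k , Unique.upTo⁺ k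
  ... | c , listed , proper = c ,
    (λ v v∈A → subst (c v ∈ˡ_) (merge-∈ L (λ _ → upTo k) v∈A) (listed v (A⊆B v∈A))) ,
    λ u v u∈A v∈A → proper u v (A⊆B u∈A) (A⊆B v∈A)

  manageable⇒choosable : Fin n → ∀ {m} → (∀ {A} → IsPart G A → Manageable G m A) → ChoosableOn G ⊤ (m + 2)
  manageable⇒choosable v {m} manageable L sized
    -- The empty colouring is extended to all of G; `v` merely fills the two slots for precoloured
    -- vertices.
    with extend-unsplit G (λ v → sized v ∈⊤) manageable ⊤ (⊂-wellFounded ⊤) {⊥} {v} {v} (⊆-min ⊤)
           (⊥-elim ∘ ∉⊥) (λ { S _ (_ , _ , x∈⊥ , _) → ∉⊥ x∈⊥ })
           (λ _ → 0) ((λ _ → ⊥-elim ∘ ∉⊥) , λ _ _ → ⊥-elim ∘ ∉⊥)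
  ... | c , colours , _ = c , colours

  choiceNumber : ∀ {k} → ChoosableOn G ⊤ k → ∀ A → ∃ (IsChoiceNumber G A)
  choiceNumber {k} choosable A = least (choosable? A) k (choosable-⊆ ⊆⊤ choosable)

-- The two bounds on the choice number

module _ {n : ℕ} (G : Graph n) (biconnected : Biconnected G)
         {c : ℕ} (minimal : ∀ k → ChoosableOn G ⊤ k → c ≤ k)
         (ch : ∀ A → ∃ (IsChoiceNumber G A)) where

  vertex : Nonempty (⊤ {n})
  vertex = 0<∣p∣⇒Nonempty ⊤ (ℕ.≤-<-trans z≤n (proj₁ biconnected))

  unmanageable : ∀ {m} → m + 2 < c → ¬ (∀ {A} → IsPart G A → Manageable G m A)
  unmanageable m+2<c manageable =
    ℕ.<⇒≱ m+2<c (minimal _ (manageable⇒choosable G (proj₁ vertex) manageable))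

  -- The choice `c ∸ 3` makes m + 2 equal to c - 1 once c is at least 3, and failure of the bound at
  -- `A` says precisely that its choice number is at most c - 3.
  small : ∀ {A} → ¬ c ≤ proj₁ (ch A) + 2 → Manageable G (c ℕ.∸ 3) A
  small {A} c≰ = inj₁ (proj₁ (ch A) , ℕ.m+n≤o⇒m≤o∸n _
    (subst (_≤ c) (sym (ℕ.+-suc (proj₁ (ch A)) 2)) (ℕ.≰⇒> c≰)) , proj₁ (proj₂ (ch A)))

  c∸3+2<c : 3 ≤ c → c ℕ.∸ 3 + 2 < c
  c∸3+2<c 3≤c = ℕ.≤-reflexive (trans (sym (ℕ.+-suc (c ℕ.∸ 3) 2)) (ℕ.m∸n+n≡m 3≤c))

  some-part : ∃ λ A → IsPart G A × ∃ λ a → IsChoiceNumber G A a × c ≤ a + 2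
  some-part with anySubset? (λ A → part? G A ×-dec c ≤? proj₁ (ch A) + 2)
  ... | yes (A , part , c≤) = A , part , proj₁ (ch A) , proj₂ (ch A) , c≤
  -- The empty set lies in some part; the failure of the bound at that part already forces `c` to be
  -- at least 3, so the truncated subtraction is exact.
  ... | no ¬∃ with unsplit⊆part G {⊥} (λ { S _ (_ , _ , x∈⊥ , _) → ∉⊥ x∈⊥ })
  ... | A , part , _ = ⊥-elim (unmanageable
    (c∸3+2<c (ℕ.≤-trans (s≤s (ℕ.m≤n+m 2 (proj₁ (ch A)))) (ℕ.≰⇒> λ c≤ → ¬∃ (A , part , c≤))))
    λ part → small λ c≤ → ¬∃ (_ , part , c≤))

  some-block : c ≤ 3 ⊎ ∃ λ A → IsBlock G A × ∃ λ a → IsChoiceNumber G A a × c ≤ a + 2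
  some-block with c ≤? 3 | anySubset? (λ A → block? G A ×-dec c ≤? proj₁ (ch A) + 2)
  ... | yes c≤3 | _ = inj₁ c≤3
  ... | no _ | yes (A , block , c≤) = inj₂ (A , block , proj₁ (ch A) , proj₂ (ch A) , c≤)
  ... | no c≰3 | no ¬∃ =
    ⊥-elim (unmanageable (c∸3+2<c (ℕ.<⇒≤ (ℕ.≰⇒> c≰3))) (manage ∘ block⊎atMostTwoNeighbours G biconnected))
    where
    manage : ∀ {A} → IsBlock G A ⊎ (∀ {x} → x ∈ A → AtMostTwoNeighbours G A x) → Manageable G (c ℕ.∸ 3) A
    manage (inj₁ block) = small λ c≤ → ¬∃ (_ , block , c≤)
    -- As `c` exceeds 3, lists of size c - 1 have at least three colours, enough for the greedy
    -- extension.
    manage (inj₂ two) = inj₂ (ℕ.m<n⇒0<n∸m (ℕ.≰⇒> c≰3) , two)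

-- Each maximum is expressed by a part or block attaining the bound, so an empty maximum contributes
-- nothing.
theorem5 : {n : ℕ} (G : Graph n) → Biconnected G →
    (c : ℕ) → IsChoiceNumber G ⊤ c →
    (Σ (Subset n) λ A → IsPart G A ×
    Σ ℕ λ a → IsChoiceNumber G A a × c ≤ a + 2)
    ×
    (c ≤ 3 ⊎
    (Σ (Subset n) λ A → IsBlock G A ×
    Σ ℕ λ a → IsChoiceNumber G A a × c ≤ a + 2))
theorem5 G biconnected c (choosable , minimal) =
  some-part G biconnected minimal (choiceNumber G choosable) ,
  some-block G biconnected minimal (choiceNumber G choosable)
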